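{- Let $n\ge 6$ be an even integer, let $c$ be an integer with $1<c<n/2$, let $S=\{\pm 1,\pm c,n/2\}\subseteq\mathbb{Z}_n$, and assume that $\Gamma=\mathrm{Cay}(\mathbb{Z}_n;S)$ is closed distance magic. Write $n=2^t\ell$, $c+1=2^\alpha\ell_1$ and $c-1=2^\beta\ell_2$, where $t,\alpha,\beta$ are non-negative integers and $\ell,\ell_1,\ell_2$ are odd positive integers. For $i\in\{1,2\}$ let $d_i=\gcd(\ell,\ell_i)$ and let $n_i$ be the positive integer with $\ell=d_in_i$. Assume that there exists $j\in\mathcal{J}_n(S)$ of type $2$. Then $\ell=d_1d_2$. Consequently, $n=2^td_1d_2$, $n_1=d_2$ and $n_2=d_1$.
   Context: $\mathrm{Cay}(\mathbb{Z}_n;S)$ is the graph with vertex set $\mathbb{Z}_n$ in which $g,h$ are adjacent iff $h-g\in S$. A graph $\Gamma=(V,E)$ of order $n$ is closed distance magic if there are a bijection $\ell:V\to\{1,\ldots,n\}$ and a positive integer $r$ such that for all $u\in V$ the sum of the labels of $u$ and all its neighbors equals $r$. For $0\le j\le n-1$ let $\chi_j(x)=\cos(2\pi xj/n)+\mathbf{i}\sin(2\pi xj/n)$ and $\chi_j(S)=\sum_{x\in S}\chi_j(x)$; $\mathcal{J}_n(S)$ is the set of $j\in\{0,\ldots,n-1\}$ with $\chi_j(S)=-1$. An even $j\in\mathcal{J}_n(S)$ is of type $2$ if $\{\frac{2\pi j}{n},\frac{2\pi jc}{n}\}=\{\pm\frac{2\pi}{3}+2k_1\pi,\pm\frac{2\pi}{3}+2k_2\pi\}$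 for some $k_1,k_2\in\mathbb{Z}$ and some (independent) choice of signs. -}

module Defs where

open import Data.Fin.Base using (Fin; toℕ; fromℕ<)
open import Data.Fin.Subset using (Subset; ⁅_⁆; _∪_; _∈_)
open import Data.Fin.Subset.Properties using (_∈?_)
open import Data.Integer.Base as ℤ using (ℤ; +_; _◃_)
open import Data.Integer.DivMod using (_%ℕ_; n%ℕd<d)
import Data.Integer.Properties as ℤ
import Data.Integer.Solver as ℤ
open import Data.List.Base using (foldr; map; filter; allFin)
open import Data.Nat.Base as ℕ using (ℕ; zero; suc)
import Data.Nat.Divisibility as ℕ
open import Data.Nat.ListAction using (sum)
import Data.Nat.Properties as ℕ
open import Data.Product.Base using (Σ; ∃-syntax; _×_; _,_; proj₁; proj₂)
open import Data.Rational.Base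
open import Data.Rational.Properties
open import Data.Rational.Solver using (module +-*-Solver)
open import Data.Rational.Unnormalised.Base as ℚᵘ using (mkℚᵘ; *≡*; *≤*)
import Data.Rational.Unnormalised.Properties as ℚᵘ
open import Data.Sign.Base using (Sign)
open import Data.Sum.Base using (_⊎_; inj₁; inj₂)
open import Function.Bundles using (_⤖_; module Bijection)
open import Relation.Binary.Core using (Rel)
open import Relation.Binary.Definitions using (Decidable)
open import Relation.Binary.PropositionalEquality
open import Relation.Unary using (Pred; _≐_)
open import Level using (0ℓ)

IsCauchy : (ℕ → ℚ) → Set
IsCauchy x = ∀ ε → 0ℚ < ε → ∃[ N ] (∀ m k → N ℕ.≤ m → N ℕ.≤ k → ∣ x m - x k ∣ < ε)

record ℝ : Set where
  constructor mkℝ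
  field
    seq    : ℕ → ℚ
    cauchy : IsCauchy seq

open ℝ public

infix 4 _≈_

_≈_ : Rel ℝ 0ℓ
x ≈ y = ∀ ε → 0ℚ < ε → ∃[ N ] (∀ k → N ℕ.≤ k → ∣ seq x k - seq y k ∣ < ε)

partialSum : (ℕ → ℚ) → ℕ → ℚ
partialSum a zero    = 0ℚ
partialSum a (suc k) = partialSum a k + a k

-- x ^ i / i !
powFact : ℚ → ℕ → ℚ
powFact x zero    = 1ℚ
powFact x (suc i) = powFact x i * (x * (+ 1 / suc i))

-- Terms of  π = Σ_{i ≥ 0} 2 · i ! / (1 · 3 · 5 ⋯ (2 i + 1)),
-- Euler's transform of Leibniz's series.
πTerm : ℕ → ℚ
πTerm zero    = + 2 / 1
πTerm (suc i) = πTerm i * (+ suc i / (3 ℕ.+ 2 ℕ.* i))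

-- The i-th derivatives of cos and sin at 0, i.e. the numerators of the
-- Maclaurin coefficients.
cos⁽_⁾ sin⁽_⁾ : ℕ → ℚ
cos⁽ zero  ⁾ = 1ℚ
cos⁽ suc i ⁾ = - sin⁽ i ⁾
sin⁽ zero  ⁾ = 0ℚ
sin⁽ suc i ⁾ = cos⁽ i ⁾

-- The k-th partial sum of Σ_i aᵢ xⁱ / i !, evaluated at the k-th
-- approximation of x.
maclaurin : (ℕ → ℚ) → (ℕ → ℚ) → ℕ → ℚ
maclaurin a x k = partialSum (λ i → a i * powFact (x k) i) k

module Convergence where
  half : ℚ → ℚ
  half ε = ½ * ε

  half-pos : ∀ {ε} → 0ℚ < ε → 0ℚ < half ε
  half-pos {ε} p = subst (_< half ε) (*-zeroʳ ½) (*-monoʳ-<-pos ½ p)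

  half+half : ∀ ε → half ε + half ε ≡ ε
  half+half ε = trans (sym (*-distribʳ-+ ε ½ ½)) (*-identityˡ ε)

  *-mono : ∀ {a b c d} → 0ℚ ≤ a → a ≤ b → 0ℚ ≤ c → c ≤ d → a * c ≤ b * d
  *-mono {a} {b} {c} {d} 0≤a a≤b 0≤c c≤d =
    ≤-trans (*-monoʳ-≤-nonNeg c {{nonNegative 0≤c}} a≤b)
            (*-monoˡ-≤-nonNeg b {{nonNegative (≤-trans 0≤a a≤b)}} c≤d)

  *-nonneg : ∀ {a b} → 0ℚ ≤ a → 0ℚ ≤ b → 0ℚ ≤ a * b
  *-nonneg {a} {b} p q =
    nonNegative⁻¹ (a * b) {{nonNeg*nonNeg⇒nonNeg a {{nonNegative p}} b {{nonNegative q}}}}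

  dist-sym : ∀ a b → ∣ a - b ∣ ≡ ∣ b - a ∣
  dist-sym a b = trans (cong ∣_∣ (solve 2 (λ a b → a :- b := :- (b :- a)) refl a b)) (∣-p∣≡∣p∣ (b - a))
    where open +-*-Solver

  triangle : ∀ a b c → ∣ a - c ∣ ≤ ∣ a - b ∣ + ∣ b - c ∣
  triangle a b c = subst (λ z → ∣ z ∣ ≤ ∣ a - b ∣ + ∣ b - c ∣)
    (solve 3 (λ a b c → (a :- b) :+ (b :- c) := a :- c) refl a b c)
    (∣p+q∣≤∣p∣+∣q∣ (a - b) (b - c))
    where open +-*-Solver

  ≤-+nonneg : ∀ p {q} → 0ℚ ≤ q → p ≤ p + q
  ≤-+nonneg p {q} 0≤q = subst (_≤ p + q) (+-identityʳ p) (+-monoʳ-≤ p 0≤q)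

  half-bound : ∀ {a b c ε} → a ≤ b + c → b < half ε → c < half ε → a < ε
  half-bound {ε = ε} p q r = ≤-<-trans p (subst (_ <_) (half+half ε) (+-mono-< q r))

  ι : ℕ → ℚ
  ι n = + n / 1

  inv : ℕ → ℚ
  inv i = + 1 / suc i

  ι-ᵘ : ∀ n → toℚᵘ (ι n) ℚᵘ.≃ mkℚᵘ (+ n) 0
  ι-ᵘ n = toℚᵘ-fromℚᵘ (mkℚᵘ (+ n) 0)

  ι-suc : ∀ n → ι (suc n) ≡ 1ℚ + ι n
  ι-suc n = toℚᵘ-injective (ℚᵘ.≃-trans (ι-ᵘ (suc n)) (ℚᵘ.≃-trans
    (*≡* (solve 1 (λ n → (con (+ 1) :+ n) :* con (+ 1)
                      := (con (+ 1) :* con (+ 1) :+ n :* con (+ 1)) :* con (+ 1)) refl (+ n)))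
    (ℚᵘ.≃-sym (ℚᵘ.≃-trans (toℚᵘ-homo-+ 1ℚ (ι n)) (ℚᵘ.+-congʳ ℚᵘ.1ℚᵘ (ι-ᵘ n))))))
    where open ℤ.+-*-Solver

  ι-inv : ∀ i → ι (suc i) * inv i ≡ 1ℚ
  ι-inv i = toℚᵘ-injective (ℚᵘ.≃-trans (toℚᵘ-homo-* (ι (suc i)) (inv i)) (ℚᵘ.≃-trans
    (ℚᵘ.*-cong (ι-ᵘ (suc i)) (toℚᵘ-fromℚᵘ (mkℚᵘ (+ 1) i)))
    (*≡* (trans (ℤ.*-assoc (+ suc i) (+ 1) (+ 1)) (trans (ℤ.*-comm (+ suc i) (+ 1))
      (cong (λ z → + 1 ℤ.* + z) (sym (ℕ.*-identityˡ (suc i)))))))))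

  /-nonneg : ∀ n d .{{_ : ℕ.NonZero d}} → 0ℚ ≤ + n / d
  /-nonneg n d = nonNegative⁻¹ (+ n / d) {{normalize-nonNeg n d}}

  ι-mono : ∀ {m n} → m ℕ.≤ n → ι m ≤ ι n
  ι-mono {m} {n} m≤n = toℚᵘ-cancel-≤ (ℚᵘ.≤-respˡ-≃ (ℚᵘ.≃-sym (ι-ᵘ m)) (ℚᵘ.≤-respʳ-≃ (ℚᵘ.≃-sym (ι-ᵘ n))
    (*≤* (ℤ.*-monoʳ-≤-nonNeg (+ 1) (ℤ.+≤+ m≤n)))))

  πRatio≤½ : ∀ i → + suc i / (3 ℕ.+ 2 ℕ.* i) ≤ ½
  πRatio≤½ i = toℚᵘ-cancel-≤ (ℚᵘ.≤-respˡ-≃ (ℚᵘ.≃-sym (toℚᵘ-fromℚᵘ (mkℚᵘ (+ suc i) (2 ℕ.+ 2 ℕ.* i))))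
    (*≤* (ℤ.+≤+ (begin
      suc i ℕ.* 2             ≡⟨ ℕ.*-comm (suc i) 2 ⟩
      2 ℕ.* suc i             ≡⟨ ℕ.*-suc 2 i ⟩
      2 ℕ.+ 2 ℕ.* i           ≤⟨ ℕ.n≤1+n _ ⟩
      3 ℕ.+ 2 ℕ.* i           ≡⟨ ℕ.*-identityˡ _ ⟨
      1 ℕ.* (3 ℕ.+ 2 ℕ.* i)   ∎))))
    where open ℕ.≤-Reasoning

  ≤ι∣↥∣ : ∀ q → q ≤ ι ℤ.∣ ↥ q ∣
  ≤ι∣↥∣ q@(mkℚ n d-1 _) = toℚᵘ-cancel-≤ (ℚᵘ.≤-respʳ-≃ (ℚᵘ.≃-sym (ι-ᵘ ℤ.∣ n ∣))
    (*≤* (ℤ.≤-trans (ℤ.≤-reflexive (ℤ.*-identityʳ n)) (ℤ.≤-trans (i≤∣i∣ n)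
      (ℤ.≤-trans (ℤ.+≤+ (ℕ.m≤m*n ℤ.∣ n ∣ (suc d-1))) (ℤ.≤-reflexive (ℤ.pos-* ℤ.∣ n ∣ (suc d-1))))))))
    where
    i≤∣i∣ : ∀ i → i ℤ.≤ + ℤ.∣ i ∣
    i≤∣i∣ (+ _)      = ℤ.≤-refl
    i≤∣i∣ ℤ.-[1+ _ ] = ℤ.-≤+

  ½^ : ℕ → ℚ
  ½^ zero    = 1ℚ
  ½^ (suc d) = ½ * ½^ d

  ½^-nonneg : ∀ d → 0ℚ ≤ ½^ d
  ½^-nonneg zero    = nonNegative⁻¹ 1ℚ
  ½^-nonneg (suc d) = *-nonneg (nonNegative⁻¹ ½) (½^-nonneg d)

  ½^≤1 : ∀ d → ½^ d ≤ 1ℚ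
  ½^≤1 zero    = ≤-refl
  ½^≤1 (suc d) = *-mono {½} {1ℚ} {½^ d} {1ℚ} (nonNegative⁻¹ ½) (≤ᵇ⇒≤ _) (½^-nonneg d) (½^≤1 d)

  ι*½^≤1 : ∀ d → ι d * ½^ d ≤ 1ℚ
  ι*½^≤1 zero    = ≤ᵇ⇒≤ _
  ι*½^≤1 (suc d) = begin
    ι (suc d) * (½ * ½^ d)        ≡⟨ cong (_* (½ * ½^ d)) (ι-suc d) ⟩
    (1ℚ + ι d) * (½ * ½^ d)       ≡⟨ solve 3 (λ a h b → (con 1ℚ :+ a) :* (h :* b) := h :* b :+ h :* (a :* b)) refl (ι d) ½ (½^ d) ⟩
    ½ * ½^ d + ½ * (ι d * ½^ d)   ≤⟨ +-mono-≤ (*-monoˡ-≤-nonNeg ½ (½^≤1 d)) (*-monoˡ-≤-nonNeg ½ (ι*½^≤1 d)) ⟩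
    ½ * 1ℚ + ½ * 1ℚ               ≡⟨⟩
    1ℚ                            ∎
    where open ≤-Reasoning
          open +-*-Solver

  ½^-small : ∀ B ε → 0ℚ ≤ B → 0ℚ < ε → ∃[ d ] ½^ d * B < ε
  ½^-small B ε 0≤B 0<ε = suc N , (begin-strict
    ½ * ½^ N * B                 ≡⟨ solve 3 (λ h b c → h :* b :* c := h :* (b :* c)) refl ½ (½^ N) B ⟩
    ½ * (½^ N * B)               ≤⟨ *-monoˡ-≤-nonNeg ½ (*-monoˡ-≤-nonNeg (½^ N) {{nonNegative (½^-nonneg N)}} B≤) ⟩
    ½ * (½^ N * (ι N * ε))       ≡⟨ solve 4 (λ h b n e → h :* (b :* (n :* e)) := h :* ((n :* b) :* e)) refl ½ (½^ N) (ι N) ε ⟩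
    ½ * ((ι N * ½^ N) * ε)       ≤⟨ *-monoˡ-≤-nonNeg ½ (*-monoʳ-≤-nonNeg ε {{nonNegative (<⇒≤ 0<ε)}} (ι*½^≤1 N)) ⟩
    ½ * (1ℚ * ε)                 ≡⟨ cong half (*-identityˡ ε) ⟩
    half ε                       ≡⟨ +-identityʳ (half ε) ⟨
    half ε + 0ℚ                  <⟨ +-monoʳ-< (half ε) (half-pos 0<ε) ⟩
    half ε + half ε              ≡⟨ half+half ε ⟩
    ε                            ∎)
    where
    open ≤-Reasoning
    open +-*-Solver
    instance
      ε-pos : Positive ε
      ε-pos = positive 0<ε
      ε-nonZero : NonZero ε
      ε-nonZero = pos⇒nonZero ε
    q : ℚ
    q = B * (1/ ε)
    N : ℕ
    N = ℤ.∣ ↥ q ∣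
    B≤ : B ≤ ι N * ε
    B≤ = begin
      B                  ≡⟨ *-identityʳ B ⟨
      B * 1ℚ             ≡⟨ cong (B *_) (*-inverseˡ ε) ⟨
      B * ((1/ ε) * ε)   ≡⟨ *-assoc B (1/ ε) ε ⟨
      q * ε              ≤⟨ *-monoʳ-≤-nonNeg ε {{nonNegative (<⇒≤ 0<ε)}} (≤ι∣↥∣ q) ⟩
      ι N * ε            ∎

  anchored⇒cauchy : ∀ x → (∀ ε → 0ℚ < ε → ∃[ N ] (∀ e → ∣ x (N ℕ.+ e) - x N ∣ < ε)) → IsCauchy x
  anchored⇒cauchy x f ε 0<ε = N , λ m k N≤m N≤k →
    half-bound (triangle (x m) (x N) (x k)) (near m N≤m) (subst (_< half ε) (dist-sym (x k) (x N)) (near k N≤k))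
    where
    N : ℕ
    N = proj₁ (f (half ε) (half-pos 0<ε))
    near : ∀ m → N ℕ.≤ m → ∣ x m - x N ∣ < half ε
    near m N≤m = subst (λ z → ∣ x z - x N ∣ < half ε) (ℕ.m+[n∸m]≡n N≤m)
      (proj₂ (f (half ε) (half-pos 0<ε)) (m ℕ.∸ N))

  module Ratio (a : ℕ → ℚ) (K : ℕ) (ratio : ∀ i → K ℕ.≤ i → ∣ a (suc i) ∣ ≤ ½ * ∣ a i ∣) where

    geometric : ∀ d → ∣ a (K ℕ.+ d) ∣ ≤ ½^ d * ∣ a K ∣
    geometric zero    = ≤-reflexive (trans (cong (λ z → ∣ a z ∣) (ℕ.+-identityʳ K)) (sym (*-identityˡ ∣ a K ∣)))
    geometric (suc d) = begin
      ∣ a (K ℕ.+ suc d) ∣      ≡⟨ cong (λ z → ∣ a z ∣) (ℕ.+-suc K d) ⟩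
      ∣ a (suc (K ℕ.+ d)) ∣    ≤⟨ ratio (K ℕ.+ d) (ℕ.m≤m+n K d) ⟩
      ½ * ∣ a (K ℕ.+ d) ∣      ≤⟨ *-monoˡ-≤-nonNeg ½ (geometric d) ⟩
      ½ * (½^ d * ∣ a K ∣)     ≡⟨ *-assoc ½ (½^ d) ∣ a K ∣ ⟨
      ½ * ½^ d * ∣ a K ∣       ∎
      where open ≤-Reasoning

    tail : ∀ k → K ℕ.≤ k → ∀ e →
           ∣ partialSum a (k ℕ.+ e) - partialSum a k ∣ + (∣ a (k ℕ.+ e) ∣ + ∣ a (k ℕ.+ e) ∣) ≤ ∣ a k ∣ + ∣ a k ∣
    tail k K≤k zero    rewrite ℕ.+-identityʳ k | +-inverseʳ (partialSum a k) = ≤-reflexive (+-identityˡ _)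
    tail k K≤k (suc e) rewrite ℕ.+-suc k e = begin
      ∣ (S + a i) - T ∣ + (∣ a (suc i) ∣ + ∣ a (suc i) ∣)
        ≤⟨ +-mono-≤ step (+-mono-≤ r r) ⟩
      (∣ S - T ∣ + ∣ a i ∣) + (½ * ∣ a i ∣ + ½ * ∣ a i ∣)
        ≡⟨ cong (λ z → (∣ S - T ∣ + ∣ a i ∣) + z) (half+half ∣ a i ∣) ⟩
      (∣ S - T ∣ + ∣ a i ∣) + ∣ a i ∣
        ≡⟨ +-assoc (∣ S - T ∣) (∣ a i ∣) (∣ a i ∣) ⟩
      ∣ S - T ∣ + (∣ a i ∣ + ∣ a i ∣)
        ≤⟨ tail k K≤k e ⟩
      ∣ a k ∣ + ∣ a k ∣ ∎
      where
      open ≤-Reasoning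
      open +-*-Solver
      i : ℕ
      i = k ℕ.+ e
      S T : ℚ
      S = partialSum a i
      T = partialSum a k
      r : ∣ a (suc i) ∣ ≤ ½ * ∣ a i ∣
      r = ratio i (ℕ.≤-trans K≤k (ℕ.m≤m+n k e))
      step : ∣ (S + a i) - T ∣ ≤ ∣ S - T ∣ + ∣ a i ∣
      step = subst (λ z → ∣ z ∣ ≤ ∣ S - T ∣ + ∣ a i ∣)
        (solve 3 (λ s t u → (s :- t) :+ u := (s :+ u) :- t) refl S T (a i))
        (∣p+q∣≤∣p∣+∣q∣ (S - T) (a i))

    partialSum-cauchy : IsCauchy (partialSum a)
    partialSum-cauchy = anchored⇒cauchy (partialSum a) λ ε 0<ε →
      let (d , small) = ½^-small ∣ a K ∣ (half ε) (0≤∣p∣ (a K)) (half-pos 0<ε)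
          N           = K ℕ.+ d
          a<          = ≤-<-trans (geometric d) small
      in N , λ e → half-bound
        (≤-trans (≤-+nonneg (∣ partialSum a (N ℕ.+ e) - partialSum a N ∣)
                   (+-mono-≤ (0≤∣p∣ (a (N ℕ.+ e))) (0≤∣p∣ (a (N ℕ.+ e)))))
                 (tail N (ℕ.m≤m+n K d) e))
        a< a<

  ∣*∣-≤ : ∀ p q {b} → 0ℚ ≤ q → q ≤ b → ∣ p * q ∣ ≤ b * ∣ p ∣
  ∣*∣-≤ p q {b} 0≤q q≤b = begin
    ∣ p * q ∣       ≡⟨ ∣p*q∣≡∣p∣*∣q∣ p q ⟩
    ∣ p ∣ * ∣ q ∣   ≡⟨ cong (∣ p ∣ *_) (0≤p⇒∣p∣≡p 0≤q) ⟩
    ∣ p ∣ * q       ≤⟨ *-monoˡ-≤-nonNeg ∣ p ∣ {{∣-∣-nonNeg p}} q≤b ⟩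
    ∣ p ∣ * b       ≡⟨ *-comm ∣ p ∣ b ⟩
    b * ∣ p ∣       ∎
    where open ≤-Reasoning

  π-cauchy : IsCauchy (partialSum πTerm)
  π-cauchy = Ratio.partialSum-cauchy πTerm 0 λ i _ →
    ∣*∣-≤ (πTerm i) (+ suc i / (3 ℕ.+ 2 ℕ.* i)) (/-nonneg (suc i) (3 ℕ.+ 2 ℕ.* i)) (πRatio≤½ i)

  powFact-nonneg : ∀ {B} → 0ℚ ≤ B → ∀ i → 0ℚ ≤ powFact B i
  powFact-nonneg 0≤B zero    = nonNegative⁻¹ 1ℚ
  powFact-nonneg 0≤B (suc i) = *-nonneg (powFact-nonneg 0≤B i) (*-nonneg 0≤B (/-nonneg 1 (suc i)))

  exp-cauchy : ∀ {B} → 0ℚ ≤ B → IsCauchy (partialSum (powFact B))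
  exp-cauchy {B} 0≤B = Ratio.partialSum-cauchy (powFact B) K λ i K≤i →
    ∣*∣-≤ (powFact B i) (B * inv i) (*-nonneg 0≤B (/-nonneg 1 (suc i))) (ratio i K≤i)
    where
    open ≤-Reasoning
    K : ℕ
    K = ℤ.∣ ↥ (B + B) ∣
    ratio : ∀ i → K ℕ.≤ i → B * inv i ≤ ½
    ratio i K≤i = begin
      B * inv i                  ≡⟨ cong (_* inv i) (trans (*-distribˡ-+ ½ B B) (half+half B)) ⟨
      ½ * (B + B) * inv i        ≡⟨ *-assoc ½ (B + B) (inv i) ⟩
      ½ * ((B + B) * inv i)      ≤⟨ *-monoˡ-≤-nonNeg ½ (*-monoʳ-≤-nonNeg (inv i) {{nonNegative (/-nonneg 1 (suc i))}}
                                      (≤-trans (≤ι∣↥∣ (B + B)) (ι-mono (ℕ.m≤n⇒m≤1+n K≤i)))) ⟩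
      ½ * (ι (suc i) * inv i)    ≡⟨ cong (½ *_) (ι-inv i) ⟩
      ½ * 1ℚ                     ≡⟨⟩
      ½                          ∎

  bounded : ∀ x → IsCauchy x → ∃[ B ] (0ℚ < B × ∃[ N ] (∀ k → N ℕ.≤ k → ∣ x k ∣ ≤ B))
  bounded x xc = B , 0<B , N , λ k N≤k → begin
    ∣ x k ∣                   ≡⟨ cong ∣_∣ (solve 2 (λ a b → a := (a :- b) :+ b) refl (x k) (x N)) ⟩
    ∣ (x k - x N) + x N ∣     ≤⟨ ∣p+q∣≤∣p∣+∣q∣ (x k - x N) (x N) ⟩
    ∣ x k - x N ∣ + ∣ x N ∣   ≤⟨ +-monoˡ-≤ ∣ x N ∣ (<⇒≤ (proj₂ (xc 1ℚ (positive⁻¹ 1ℚ)) k N N≤k ℕ.≤-refl)) ⟩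
    1ℚ + ∣ x N ∣              ∎
    where
    open ≤-Reasoning
    open +-*-Solver
    N : ℕ
    N = proj₁ (xc 1ℚ (positive⁻¹ 1ℚ))
    B : ℚ
    B = 1ℚ + ∣ x N ∣
    0<B : 0ℚ < B
    0<B = positive⁻¹ B {{pos+nonNeg⇒pos 1ℚ ∣ x N ∣ {{∣-∣-nonNeg (x N)}}}}

  module Bound {B : ℚ} (0≤B : 0ℚ ≤ B) (a : ℕ → ℚ) (∣a∣≤1 : ∀ i → ∣ a i ∣ ≤ 1ℚ) where
    open ≤-Reasoning
    open +-*-Solver

    e : ℕ → ℚ
    e = powFact B

    0≤e : ∀ i → 0ℚ ≤ e i
    0≤e = powFact-nonneg 0≤B

    F : ℚ → ℕ → ℚ
    F x = partialSum (λ i → a i * powFact x i)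

    E : ℕ → ℚ
    E = partialSum e

    ∣powFact∣≤ : ∀ {x} → ∣ x ∣ ≤ B → ∀ i → ∣ powFact x i ∣ ≤ e i
    ∣powFact∣≤ {x} x≤B zero    = ≤-refl
    ∣powFact∣≤ {x} x≤B (suc i) = begin
      ∣ powFact x i * (x * inv i) ∣       ≡⟨ ∣p*q∣≡∣p∣*∣q∣ (powFact x i) (x * inv i) ⟩
      ∣ powFact x i ∣ * ∣ x * inv i ∣     ≤⟨ *-mono (0≤∣p∣ (powFact x i)) (∣powFact∣≤ x≤B i) (0≤∣p∣ (x * inv i)) step ⟩
      e i * (B * inv i)                   ∎
      where
      0≤inv : 0ℚ ≤ inv i
      0≤inv = /-nonneg 1 (suc i)
      step : ∣ x * inv i ∣ ≤ B * inv i
      step = begin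
        ∣ x * inv i ∣       ≤⟨ ∣*∣-≤ x (inv i) 0≤inv ≤-refl ⟩
        inv i * ∣ x ∣       ≤⟨ *-monoˡ-≤-nonNeg (inv i) {{nonNegative 0≤inv}} x≤B ⟩
        inv i * B           ≡⟨ *-comm (inv i) B ⟩
        B * inv i           ∎

    -- d/dB (B ^ i / i !)
    e′ : ℕ → ℚ
    e′ zero    = 0ℚ
    e′ (suc i) = e i

    e′≡ : ∀ i → e′ i * B ≡ ι i * e i
    e′≡ zero    = refl-0
      where
      refl-0 : 0ℚ * B ≡ 0ℚ * 1ℚ
      refl-0 = *-zeroˡ B
    e′≡ (suc i) = begin-equality
      e i * B                                ≡⟨ *-identityˡ (e i * B) ⟨
      1ℚ * (e i * B)                         ≡⟨ cong (_* (e i * B)) (ι-inv i) ⟨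
      ι (suc i) * inv i * (e i * B)          ≡⟨ solve 4 (λ n v p b → n :* v :* (p :* b) := n :* (p :* (b :* v))) refl (ι (suc i)) (inv i) (e i) B ⟩
      ι (suc i) * (e i * (B * inv i))        ∎

    powFact-lipschitz : ∀ {x y} → ∣ x ∣ ≤ B → ∣ y ∣ ≤ B → ∀ i →
                        ∣ powFact x i - powFact y i ∣ ≤ e′ i * ∣ x - y ∣
    powFact-lipschitz {x} {y} x≤B y≤B zero    = ≤-reflexive (sym (*-zeroˡ ∣ x - y ∣))
    powFact-lipschitz {x} {y} x≤B y≤B (suc i) = begin
      ∣ p * (x * v) - q * (y * v) ∣
        ≡⟨ cong ∣_∣ (solve 5 (λ p q x y v → p :* (x :* v) :- q :* (y :* v) := (((p :- q) :* x) :+ (q :* (x :- y))) :* v) refl p q x y v) ⟩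
      ∣ ((p - q) * x + q * (x - y)) * v ∣
        ≤⟨ ∣*∣-≤ ((p - q) * x + q * (x - y)) v 0≤v ≤-refl ⟩
      v * ∣ (p - q) * x + q * (x - y) ∣
        ≤⟨ *-monoˡ-≤-nonNeg v {{nonNegative 0≤v}} (≤-trans (∣p+q∣≤∣p∣+∣q∣ ((p - q) * x) (q * (x - y))) (+-mono-≤ s₁ s₂)) ⟩
      v * (e′ i * D * B + e i * D)
        ≡⟨ solve 5 (λ v e′ D B e → v :* (e′ :* D :* B :+ e :* D) := v :* ((e′ :* B :+ e) :* D)) refl v (e′ i) D B (e i) ⟩
      v * ((e′ i * B + e i) * D)
        ≡⟨ cong (λ z → v * ((z + e i) * D)) (e′≡ i) ⟩
      v * ((ι i * e i + e i) * D)
        ≡⟨ solve 4 (λ v n e D → v :* ((n :* e :+ e) :* D) := ((con 1ℚ :+ n) :* v) :* (e :* D)) refl v (ι i) (e i) D ⟩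
      ((1ℚ + ι i) * v) * (e i * D)
        ≡⟨ cong (λ z → (z * v) * (e i * D)) (ι-suc i) ⟨
      (ι (suc i) * v) * (e i * D)
        ≡⟨ cong (_* (e i * D)) (ι-inv i) ⟩
      1ℚ * (e i * D)
        ≡⟨ *-identityˡ (e i * D) ⟩
      e i * D ∎
      where
      p q v D : ℚ
      p = powFact x i
      q = powFact y i
      v = inv i
      D = ∣ x - y ∣
      0≤v : 0ℚ ≤ v
      0≤v = /-nonneg 1 (suc i)
      s₁ : ∣ (p - q) * x ∣ ≤ e′ i * D * B
      s₁ = ≤-trans (≤-reflexive (∣p*q∣≡∣p∣*∣q∣ (p - q) x))
             (*-mono (0≤∣p∣ (p - q)) (powFact-lipschitz x≤B y≤B i) (0≤∣p∣ x) x≤B)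
      s₂ : ∣ q * (x - y) ∣ ≤ e i * D
      s₂ = ≤-trans (≤-reflexive (∣p*q∣≡∣p∣*∣q∣ q (x - y)))
             (*-monoʳ-≤-nonNeg D {{∣-∣-nonNeg (x - y)}} (∣powFact∣≤ y≤B i))

    ∣a*∣≤ : ∀ i z → ∣ a i * z ∣ ≤ ∣ z ∣
    ∣a*∣≤ i z = begin
      ∣ a i * z ∣       ≡⟨ ∣p*q∣≡∣p∣*∣q∣ (a i) z ⟩
      ∣ a i ∣ * ∣ z ∣   ≤⟨ *-monoʳ-≤-nonNeg ∣ z ∣ {{∣-∣-nonNeg z}} (∣a∣≤1 i) ⟩
      1ℚ * ∣ z ∣        ≡⟨ *-identityˡ ∣ z ∣ ⟩
      ∣ z ∣             ∎

    F-lipschitz : ∀ {x y} → ∣ x ∣ ≤ B → ∣ y ∣ ≤ B → ∀ m →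
                  ∣ F x m - F y m ∣ ≤ partialSum e′ m * ∣ x - y ∣
    F-lipschitz {x} {y} x≤B y≤B zero    = ≤-reflexive (sym (*-zeroˡ ∣ x - y ∣))
    F-lipschitz {x} {y} x≤B y≤B (suc m) = begin
      ∣ (F x m + a m * powFact x m) - (F y m + a m * powFact y m) ∣
        ≡⟨ cong ∣_∣ (solve 5 (λ f g a p q → (f :+ a :* p) :- (g :+ a :* q) := (f :- g) :+ a :* (p :- q)) refl
             (F x m) (F y m) (a m) (powFact x m) (powFact y m)) ⟩
      ∣ (F x m - F y m) + a m * (powFact x m - powFact y m) ∣
        ≤⟨ ∣p+q∣≤∣p∣+∣q∣ (F x m - F y m) (a m * (powFact x m - powFact y m)) ⟩
      ∣ F x m - F y m ∣ + ∣ a m * (powFact x m - powFact y m) ∣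
        ≤⟨ +-mono-≤ (F-lipschitz x≤B y≤B m)
             (≤-trans (∣a*∣≤ m (powFact x m - powFact y m)) (powFact-lipschitz x≤B y≤B m)) ⟩
      partialSum e′ m * ∣ x - y ∣ + e′ m * ∣ x - y ∣
        ≡⟨ *-distribʳ-+ ∣ x - y ∣ (partialSum e′ m) (e′ m) ⟨
      (partialSum e′ m + e′ m) * ∣ x - y ∣ ∎

    partialSum-e′ : ∀ m → partialSum e′ (suc m) ≡ E m
    partialSum-e′ zero    = refl
    partialSum-e′ (suc m) = cong (_+ e m) (partialSum-e′ m)

    F-tail : ∀ {x} → ∣ x ∣ ≤ B → ∀ k d → ∣ F x (k ℕ.+ d) - F x k ∣ ≤ E (k ℕ.+ d) - E k
    F-tail {x} x≤B k zero    rewrite ℕ.+-identityʳ k | +-inverseʳ (F x k) | +-inverseʳ (E k) = ≤-refl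
    F-tail {x} x≤B k (suc d) rewrite ℕ.+-suc k d = begin
      ∣ (F x i + t) - F x k ∣
        ≡⟨ cong ∣_∣ (solve 3 (λ f t g → (f :+ t) :- g := (f :- g) :+ t) refl (F x i) t (F x k)) ⟩
      ∣ (F x i - F x k) + t ∣
        ≤⟨ ∣p+q∣≤∣p∣+∣q∣ (F x i - F x k) t ⟩
      ∣ F x i - F x k ∣ + ∣ t ∣
        ≤⟨ +-mono-≤ (F-tail x≤B k d) (≤-trans (∣a*∣≤ i (powFact x i)) (∣powFact∣≤ x≤B i)) ⟩
      (E i - E k) + e i
        ≡⟨ solve 3 (λ f g t → (f :- g) :+ t := (f :+ t) :- g) refl (E i) (E k) (e i) ⟩
      (E i + e i) - E k ∎
      where
      i : ℕ
      i = k ℕ.+ d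
      t : ℚ
      t = a i * powFact x i

  scale-small : ∀ L ε → 0ℚ < L → 0ℚ < ε → ∃[ δ ] (0ℚ < δ × L * δ ≡ ε)
  scale-small L ε 0<L 0<ε = δ , 0<δ , (begin
    L * ((1/ L) * ε)   ≡⟨ *-assoc L (1/ L) ε ⟨
    L * (1/ L) * ε     ≡⟨ cong (_* ε) (*-inverseʳ L) ⟩
    1ℚ * ε             ≡⟨ *-identityˡ ε ⟩
    ε                  ∎)
    where
    open ≡-Reasoning
    instance
      L-pos : Positive L
      L-pos = positive 0<L
      L-nonZero : NonZero L
      L-nonZero = pos⇒nonZero L
    δ : ℚ
    δ = (1/ L) * ε
    0<δ : 0ℚ < δ
    0<δ = positive⁻¹ δ {{pos*pos⇒pos (1/ L) {{1/pos⇒pos L}} ε {{positive 0<ε}}}}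

  maclaurin-cauchy : ∀ {a x} → (∀ i → ∣ a i ∣ ≤ 1ℚ) → IsCauchy x → IsCauchy (maclaurin a x)
  maclaurin-cauchy {a} {x} ∣a∣≤1 xc = anchored⇒cauchy (maclaurin a x) main
    where
    open ≤-Reasoning
    B : ℚ
    B = proj₁ (bounded x xc)
    0≤B : 0ℚ ≤ B
    0≤B = <⇒≤ (proj₁ (proj₂ (bounded x xc)))
    N₀ : ℕ
    N₀ = proj₁ (proj₂ (proj₂ (bounded x xc)))
    x≤B : ∀ k → N₀ ℕ.≤ k → ∣ x k ∣ ≤ B
    x≤B = proj₂ (proj₂ (proj₂ (bounded x xc)))
    open Bound 0≤B a ∣a∣≤1
    Ec : IsCauchy E
    Ec = exp-cauchy 0≤B
    L : ℚ
    L = proj₁ (bounded E Ec)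
    0<L : 0ℚ < L
    0<L = proj₁ (proj₂ (bounded E Ec))
    N₁ : ℕ
    N₁ = proj₁ (proj₂ (proj₂ (bounded E Ec)))
    E≤L : ∀ k → N₁ ℕ.≤ k → E k ≤ L
    E≤L k N₁≤k = ≤-trans (p≤∣p∣ (E k)) (proj₂ (proj₂ (proj₂ (bounded E Ec))) k N₁≤k)
      where
      p≤∣p∣ : ∀ p → p ≤ ∣ p ∣
      p≤∣p∣ p with ≤-total 0ℚ p
      ... | inj₁ 0≤p = ≤-reflexive (sym (0≤p⇒∣p∣≡p 0≤p))
      ... | inj₂ p≤0 = ≤-trans p≤0 (0≤∣p∣ p)

    main : ∀ ε → 0ℚ < ε → ∃[ N ] (∀ d → ∣ maclaurin a x (N ℕ.+ d) - maclaurin a x N ∣ < ε)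
    main ε 0<ε = N , λ d → half-bound (triangle (F (x (N ℕ.+ d)) (N ℕ.+ d)) (F (x N) (N ℕ.+ d)) (F (x N) N)) (near d) (far d)
      where
      δs = scale-small L (half ε) 0<L (half-pos 0<ε)
      δ : ℚ
      δ = proj₁ δs
      xδ = xc δ (proj₁ (proj₂ δs))
      Eε = Ec (half ε) (half-pos 0<ε)
      M : ℕ
      M = N₀ ℕ.+ N₁ ℕ.+ proj₁ xδ ℕ.+ proj₁ Eε
      N : ℕ
      N = suc M
      N₀≤N : N₀ ℕ.≤ N
      N₀≤N = ℕ.m≤n⇒m≤1+n (ℕ.≤-trans (ℕ.m≤m+n N₀ N₁) (ℕ.≤-trans (ℕ.m≤m+n _ (proj₁ xδ)) (ℕ.m≤m+n _ (proj₁ Eε))))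
      N₁≤M : N₁ ℕ.≤ M
      N₁≤M = ℕ.≤-trans (ℕ.m≤n+m N₁ N₀) (ℕ.≤-trans (ℕ.m≤m+n _ (proj₁ xδ)) (ℕ.m≤m+n _ (proj₁ Eε)))
      Nx≤N : proj₁ xδ ℕ.≤ N
      Nx≤N = ℕ.m≤n⇒m≤1+n (ℕ.≤-trans (ℕ.m≤n+m (proj₁ xδ) (N₀ ℕ.+ N₁)) (ℕ.m≤m+n _ (proj₁ Eε)))
      NE≤N : proj₁ Eε ℕ.≤ N
      NE≤N = ℕ.m≤n⇒m≤1+n (ℕ.m≤n+m (proj₁ Eε) (N₀ ℕ.+ N₁ ℕ.+ proj₁ xδ))
      up : ∀ {k} d → k ℕ.≤ N → k ℕ.≤ N ℕ.+ d
      up d p = ℕ.≤-trans p (ℕ.m≤m+n N d)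
      near : ∀ d → ∣ F (x (N ℕ.+ d)) (N ℕ.+ d) - F (x N) (N ℕ.+ d) ∣ < half ε
      near d = begin-strict
        ∣ F (x (N ℕ.+ d)) (N ℕ.+ d) - F (x N) (N ℕ.+ d) ∣
          ≤⟨ F-lipschitz (x≤B _ (up d N₀≤N)) (x≤B _ N₀≤N) (N ℕ.+ d) ⟩
        partialSum e′ (N ℕ.+ d) * ∣ x (N ℕ.+ d) - x N ∣
          ≡⟨ cong (_* ∣ x (N ℕ.+ d) - x N ∣) (partialSum-e′ (M ℕ.+ d)) ⟩
        E (M ℕ.+ d) * ∣ x (N ℕ.+ d) - x N ∣
          ≤⟨ *-monoʳ-≤-nonNeg ∣ x (N ℕ.+ d) - x N ∣ {{∣-∣-nonNeg (x (N ℕ.+ d) - x N)}}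
               (E≤L _ (ℕ.≤-trans N₁≤M (ℕ.m≤m+n _ d))) ⟩
        L * ∣ x (N ℕ.+ d) - x N ∣
          <⟨ *-monoʳ-<-pos L {{positive 0<L}} (proj₂ xδ _ _ (up d Nx≤N) Nx≤N) ⟩
        L * δ
          ≡⟨ proj₂ (proj₂ δs) ⟩
        half ε ∎
      far : ∀ d → ∣ F (x N) (N ℕ.+ d) - F (x N) N ∣ < half ε
      far d = begin-strict
        ∣ F (x N) (N ℕ.+ d) - F (x N) N ∣   ≤⟨ F-tail (x≤B N N₀≤N) N d ⟩
        E (N ℕ.+ d) - E N                   ≡⟨ 0≤p⇒∣p∣≡p (≤-trans (0≤∣p∣ _) (F-tail (x≤B N N₀≤N) N d)) ⟨
        ∣ E (N ℕ.+ d) - E N ∣               <⟨ proj₂ Eε _ _ (up d NE≤N) NE≤N ⟩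
        half ε                              ∎

  ∣cos⁽⁾∣≤1 : ∀ i → ∣ cos⁽ i ⁾ ∣ ≤ 1ℚ
  ∣sin⁽⁾∣≤1 : ∀ i → ∣ sin⁽ i ⁾ ∣ ≤ 1ℚ
  ∣cos⁽⁾∣≤1 zero    = ≤-refl
  ∣cos⁽⁾∣≤1 (suc i) = subst (_≤ 1ℚ) (sym (∣-p∣≡∣p∣ sin⁽ i ⁾)) (∣sin⁽⁾∣≤1 i)
  ∣sin⁽⁾∣≤1 zero    = ≤ᵇ⇒≤ _
  ∣sin⁽⁾∣≤1 (suc i) = ∣cos⁽⁾∣≤1 i

  const-cauchy : ∀ q → IsCauchy (λ _ → q)
  const-cauchy q ε 0<ε = 0 , λ _ _ _ _ → subst (λ z → ∣ z ∣ < ε) (sym (+-inverseʳ q)) 0<ε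

  +-cauchy : ∀ {x y} → IsCauchy x → IsCauchy y → IsCauchy (λ k → x k + y k)
  +-cauchy {x} {y} xc yc ε 0<ε = M ℕ.+ N , λ m k p q → half-bound
    (subst (λ z → ∣ z ∣ ≤ ∣ x m - x k ∣ + ∣ y m - y k ∣)
      (solve 4 (λ a b c d → (a :- b) :+ (c :- d) := (a :+ c) :- (b :+ d)) refl (x m) (x k) (y m) (y k))
      (∣p+q∣≤∣p∣+∣q∣ (x m - x k) (y m - y k)))
    (proj₂ (xc (half ε) (half-pos 0<ε)) m k (ℕ.m+n≤o⇒m≤o M p) (ℕ.m+n≤o⇒m≤o M q))
    (proj₂ (yc (half ε) (half-pos 0<ε)) m k (ℕ.m+n≤o⇒n≤o M p) (ℕ.m+n≤o⇒n≤o M q))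
    where
    open +-*-Solver
    M N : ℕ
    M = proj₁ (xc (half ε) (half-pos 0<ε))
    N = proj₁ (yc (half ε) (half-pos 0<ε))

  ·-cauchy : ∀ q {x} → IsCauchy x → IsCauchy (λ k → q * x k)
  ·-cauchy q {x} xc ε 0<ε =
    let δ , 0<δ , Lδ≡ε = scale-small L ε 0<L 0<ε
        N , xδ         = xc δ 0<δ
    in N , λ m k p r → begin-strict
      ∣ q * x m - q * x k ∣   ≡⟨ cong ∣_∣ (solve 3 (λ q a b → q :* a :- q :* b := q :* (a :- b)) refl q (x m) (x k)) ⟩
      ∣ q * (x m - x k) ∣     ≡⟨ ∣p*q∣≡∣p∣*∣q∣ q (x m - x k) ⟩
      ∣ q ∣ * ∣ x m - x k ∣   ≤⟨ *-monoʳ-≤-nonNeg ∣ x m - x k ∣ {{∣-∣-nonNeg (x m - x k)}} ∣q∣≤L ⟩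
      L * ∣ x m - x k ∣       <⟨ *-monoʳ-<-pos L {{positive 0<L}} (xδ m k p r) ⟩
      L * δ                   ≡⟨ Lδ≡ε ⟩
      ε                       ∎
    where
    open ≤-Reasoning
    open +-*-Solver
    L : ℚ
    L = 1ℚ + ∣ q ∣
    0<L : 0ℚ < L
    0<L = positive⁻¹ L {{pos+nonNeg⇒pos 1ℚ ∣ q ∣ {{∣-∣-nonNeg q}}}}
    ∣q∣≤L : ∣ q ∣ ≤ L
    ∣q∣≤L = subst (_≤ L) (+-identityˡ ∣ q ∣) (+-monoˡ-≤ ∣ q ∣ (nonNegative⁻¹ 1ℚ))

open Convergence

infixl 6 _+ᴿ_
infixr 7 _·_

fromℚ : ℚ → ℝ
fromℚ q = mkℝ (λ _ → q) (const-cauchy q)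

_+ᴿ_ : ℝ → ℝ → ℝ
x +ᴿ y = mkℝ (λ k → seq x k + seq y k) (+-cauchy {seq x} {seq y} (cauchy x) (cauchy y))

_·_ : ℚ → ℝ → ℝ
q · x = mkℝ (λ k → q * seq x k) (·-cauchy q (cauchy x))

π : ℝ
π = mkℝ (partialSum πTerm) π-cauchy

cos : ℝ → ℝ
cos x = mkℝ (maclaurin cos⁽_⁾ (seq x)) (maclaurin-cauchy ∣cos⁽⁾∣≤1 (cauchy x))

sin : ℝ → ℝ
sin x = mkℝ (maclaurin sin⁽_⁾ (seq x)) (maclaurin-cauchy ∣sin⁽⁾∣≤1 (cauchy x))

record ℂ : Set where
  constructor _+i_
  field
    re : ℝ
    im : ℝ

open ℂ public

infix 4 _≈ᶜ_

_≈ᶜ_ : Rel ℂ 0ℓ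
z ≈ᶜ w = re z ≈ re w × im z ≈ im w

_+ᶜ_ : ℂ → ℂ → ℂ
z +ᶜ w = (re z +ᴿ re w) +i (im z +ᴿ im w)

0ᶜ -1ᶜ : ℂ
0ᶜ  = fromℚ 0ℚ +i fromℚ 0ℚ
-1ᶜ = fromℚ (- 1ℚ) +i fromℚ 0ℚ

record Graph (n : ℕ) : Set₁ where
  field
    Adj  : Rel (Fin n) 0ℓ
    adj? : Decidable Adj

open Graph public

-- ℤₙ is represented by Fin n.
residue : (n : ℕ) .{{_ : ℕ.NonZero n}} → ℤ → Fin n
residue n a = fromℕ< (n%ℕd<d a n)

-- Cay S is a simple graph whenever S = - S and 0 ∉ S.
Cay : (n : ℕ) .{{_ : ℕ.NonZero n}} → Subset n → Graph n
Cay n S = record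
  { Adj  = λ g h → residue n (+ toℕ h ℤ.- + toℕ g) ∈ S
  ; adj? = λ g h → residue n (+ toℕ h ℤ.- + toℕ g) ∈? S
  }

-- The label set {1, …, n} is Fin n shifted by one.
label : ∀ {n} → Fin n ⤖ Fin n → Fin n → ℕ
label f u = suc (toℕ (Bijection.to f u))

ClosedDistanceMagic : ∀ {n} → Graph n → Set
ClosedDistanceMagic {n} Γ =
  Σ (Fin n ⤖ Fin n) λ f → ∃[ r ] (0 ℕ.< r ×
    (∀ u → label f u ℕ.+ sum (map (label f) (filter (adj? Γ u) (allFin n))) ≡ r))

-- 2 π m / n
angle : (n : ℕ) .{{_ : ℕ.NonZero n}} → ℕ → ℝ
angle n m = (+ (2 ℕ.* m) / n) · π

χ : (n : ℕ) .{{_ : ℕ.NonZero n}} → Fin n → Fin n → ℂ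
χ n j x = cos θ +i sin θ
  where
  θ : ℝ
  θ = angle n (toℕ x ℕ.* toℕ j)

χ-sum : (n : ℕ) .{{_ : ℕ.NonZero n}} → Fin n → Subset n → ℂ
χ-sum n j S = foldr _+ᶜ_ 0ᶜ (map (χ n j) (filter (_∈? S) (allFin n)))

𝒥 : (n : ℕ) .{{_ : ℕ.NonZero n}} → Subset n → Pred (Fin n) 0ℓ
𝒥 n S j = χ-sum n j S ≈ᶜ -1ᶜ

-- {± 1, ± c, n / 2}
connectionSet : (n : ℕ) .{{_ : ℕ.NonZero n}} → ℕ → Subset n
connectionSet n c =
  ⁅ residue n (+ 1) ⁆ ∪ ⁅ residue n (ℤ.- (+ 1)) ⁆ ∪
  ⁅ residue n (+ c) ⁆ ∪ ⁅ residue n (ℤ.- (+ c)) ⁆ ∪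
  ⁅ residue n (+ (n ℕ./ 2)) ⁆

｛_,_｝ : ℝ → ℝ → Pred ℝ 0ℓ
｛ x , y ｝ z = z ≈ x ⊎ z ≈ y

-- ± 2 π / 3 + 2 k π
type2Angle : Sign → ℤ → ℝ
type2Angle s k = ((s ◃ 2) / 3) · π +ᴿ ((+ 2 ℤ.* k) / 1) · π

IsType2 : (n : ℕ) .{{_ : ℕ.NonZero n}} → ℕ → Pred (Fin n) 0ℓ
IsType2 n c j =
  2 ℕ.∣ toℕ j ×
  𝒥 n (connectionSet n c) j ×
  (∃[ s₁ ] ∃[ s₂ ] ∃[ k₁ ] ∃[ k₂ ]
    ｛ angle n (toℕ j) , angle n (toℕ j ℕ.* c) ｝ ≐ ｛ type2Angle s₁ k₁ , type2Angle s₂ k₂ ｝)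

{-# OPTIONS --safe #-}
module Submission where

-- Let F : ℤ → ℤ be the labelling, viewed as an n-periodic function, and let X
-- be the shift operator.  With m = n / 2, the function F - Xᵐ F is annihilated
-- by X + X⁻¹ + Xᶜ + X⁻ᶜ = X⁻ᶜ (1 + Xᶜ⁺¹)(1 + Xᶜ⁻¹), so it has period
-- 2 (c² - 1).  Up to a constant, F + Xᵐ F is annihilated by
-- P(X) = 2 + X + X⁻¹ + Xᶜ + X⁻ᶜ.  By the Frobenius congruence
-- P(X)ᵖ ≡ P(Xᵖ) mod p, for a bounded function and every large prime p the
-- function is annihilated by P(Xᵖ) as well, hence by P(Xᵏ) for every k coprime
-- to its period (this replaces Galois conjugation of roots of unity).  A j of
-- type 2 forces 3 ∤ c.  Comparing the relations for k = 1 + s N / p shows that a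
-- period N can be divided by every prime p ≥ 5, and by 3 if 9 ∣ N; so F + Xᵐ F
-- has a period 3 · 2ᵇ.  As 3 ∣ c² - 1, F has a period 2ᵇ⁺¹ (c² - 1), and as F is
-- injective modulo n, the odd part of n divides c² - 1.

open import Defs hiding (_≈_)
open import Algebra.Bundles using (CommutativeSemiring)
import Algebra.Properties.CommutativeMonoid.Mult as CommutativeMult
import Algebra.Properties.CommutativeSemiring.Binomial as Binomial
import Algebra.Properties.Semiring.Exp as Exp
import Algebra.Properties.Semiring.Mult as Mult
import Algebra.Properties.Semiring.Sum as Sum
import Algebra.Structures.Biased as Biased
open import Data.Empty using (⊥-elim)
open import Data.Fin.Base using (Fin; zero; suc; toℕ; inject₁)
import Data.Fin.Properties as Fin
open import Data.Fin.Subset using (⁅_⁆) renaming (_∈_ to _∈ₛ_)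
open import Data.Fin.Subset.Properties using (x∈p∪q⁻; x∈p∪q⁺; x∈⁅x⁆; x∈⁅y⁆⇒x≡y)
open import Data.Integer.Base as ℤ using (ℤ; +_; _◃_)
open import Data.Integer.DivMod using (_%ℕ_; _/ℕ_; a≡a%ℕn+[a/ℕn]*n; n%ℕd<d)
import Data.Integer.Divisibility.Signed as ℤ
import Data.Integer.Properties as ℤ
open import Data.Integer.Tactic.RingSolver using (solve-∀)
open import Data.List.Base using (List; []; _∷_; _++_; map; length; filter; allFin)
import Data.List.Properties as List
open import Data.List.Membership.Propositional using (_∈_)
open import Data.List.Membership.Propositional.Properties using (∈-filter⁺; ∈-filter⁻; ∈-allFin; ∈-map⁺; ∈-map⁻)
open import Data.List.Membership.Propositional.Properties.WithK using (unique∧set⇒bag)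
open import Data.List.Relation.Binary.BagAndSetEquality using (∼bag⇒↭)
open import Data.List.Relation.Binary.Permutation.Propositional using (_↭_)
open import Data.List.Relation.Binary.Permutation.Propositional.Properties using (map⁺)
open import Data.List.Relation.Unary.All as All using (All; []; _∷_)
open import Data.List.Relation.Unary.AllPairs as AllPairs using (AllPairs)
import Data.List.Relation.Unary.AllPairs.Properties as AllPairs
open import Data.List.Relation.Unary.Any using (here; there)
open import Data.List.Relation.Unary.Linked using ([-]; _∷_)
open import Data.List.Relation.Unary.Linked.Properties using (Linked⇒AllPairs)
open import Data.List.Relation.Unary.Unique.Propositional using (Unique)
import Data.List.Relation.Unary.Unique.Propositional.Properties as Unique
open import Data.Nat.Base as ℕ using (ℕ; zero; suc; _!; NonZero)
open import Data.Nat.Combinatorics using (_C_; nCn≡1; nCk≡n!/k![n-k]!; k![n∸k]!∣n!)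
open import Data.Nat.Coprimality as Coprime using (Coprime; coprime?)
open import Data.Nat.Divisibility as ℕ using (divides; _∣?_)
import Data.Nat.DivMod as ℕ
import Data.Nat.GCD as ℕ
open import Data.Nat.GCD using (module Bézout)
open import Data.Nat.ListAction as ListAction using (product)
open import Data.Nat.ListAction.Properties using (sum-↭; ∈⇒∣product)
open import Data.Nat.Primality using (Prime; euclidsLemma; prime[2]; ¬prime[0]; ¬prime[1]; prime⇒nonZero; prime⇒nonTrivial; prime⇒irreducible; composite[4]; composite⇒¬prime; productOfPrimes≢0)
open import Data.Nat.Primality.Factorisation using (factorise; module PrimeFactorisation)
import Data.Nat.Properties as ℕ
open import Data.Nat.Tactic.RingSolver using () renaming (solve-∀ to ℕ-solve-∀)
open import Data.Product.Base using (∃-syntax; _×_; _,_; proj₁; proj₂)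
open import Data.Rational.Base as ℚ using (ℚ; 0ℚ; 1ℚ)
import Data.Rational.Properties as ℚ
open import Data.Rational.Solver using (module +-*-Solver)
open import Data.Rational.Unnormalised.Base as ℚᵘ using (mkℚᵘ)
import Data.Rational.Unnormalised.Properties as ℚᵘ
open import Data.Sign.Base using (Sign)
open import Data.Sum.Base using (_⊎_; inj₁; inj₂)
open import Data.Vec.Functional using (Vector; tail; init; last)
open import Function.Bundles using (_⤖_; mk⇔; module Bijection)
open import Level using (0ℓ)
open import Relation.Binary.Definitions using (tri<; tri≈; tri>)
open import Relation.Binary.PropositionalEquality as ≡ using (_≡_)
open import Relation.Binary.Structures using (IsEquivalence)
open import Relation.Nullary.Decidable using (yes; no)
open import Relation.Nullary.Negation using (¬_; contradiction)

-- The factor 3 left in the period of F + Xᵐ F is genuine: for 3 ∤ c a primitive cube root of unity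
-- is a zero of P, because 2 - 1 - 1 = 0. Primes p ≥ 5 are excluded by size instead of by knowing
-- the zeros of P. With N = p M and p ∤ c, summing over s < p turns the relation for u = (Xᴹ - 1) g
-- into a statement about 2 p u, since all other terms cancel along orbits. At most one k = 1 + s M
-- is divisible by p when p ∤ M, and its expression is at most P(1) · max |u| = 6 max |u|. Hence u =
-- 0 once 2 p > 6. The prime 3 just misses this bound, which is why it can be handled only when 3 ∣
-- M, where no k is exceptional. Primes dividing c spoil the cancellation at ± c k and are treated
-- by comparing consecutive k.
--
-- Integrality carries the conjugation: a congruence modulo p between values smaller than p is an
-- equality. An exponent k with small prime factors must therefore first be moved, by a multiple of
-- the period, to one whose prime factors are all large.

-- The Frobenius congruence in a commutative semiring.

prime∣! : ∀ {p} → Prime p → ∀ m → p ℕ.∣ m ! → p ℕ.≤ m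
prime∣! pp zero    p∣1 = contradiction (ℕ.∣⇒≤ p∣1) (ℕ.<⇒≱ (ℕ.nonTrivial⇒n>1 _ {{prime⇒nonTrivial pp}}))
prime∣! pp (suc m) p∣m! with euclidsLemma (suc m) (m !) pp p∣m!
... | inj₁ p∣1+m = ℕ.∣⇒≤ p∣1+m
... | inj₂ p∣m!  = ℕ.m≤n⇒m≤1+n (prime∣! pp m p∣m!)

prime∣C : ∀ {p} → Prime p → ∀ k → 0 ℕ.< k → k ℕ.< p → p ℕ.∣ p C k
prime∣C {p@(suc _)} pp k 0<k k<p with euclidsLemma (p C k) (k ! ℕ.* (p ℕ.∸ k) !) pp p∣
  where
  k≤p : k ℕ.≤ p
  k≤p = ℕ.<⇒≤ k<p
  instance
    nz : NonZero (k ! ℕ.* (p ℕ.∸ k) !)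
    nz = ℕ._!*_!≢0 k (p ℕ.∸ k)
  p∣ : p ℕ.∣ (p C k) ℕ.* (k ! ℕ.* (p ℕ.∸ k) !)
  p∣ = ≡.subst (p ℕ.∣_)
    (≡.sym (≡.trans (≡.cong (ℕ._* (k ! ℕ.* (p ℕ.∸ k) !)) (nCk≡n!/k![n-k]! k≤p))
      (ℕ.m/n*n≡m (k![n∸k]!∣n! k≤p))))
    (ℕ.m∣m*n _)
... | inj₁ p∣C = p∣C
... | inj₂ p∣k![p-k]! with euclidsLemma (k !) ((p ℕ.∸ k) !) pp p∣k![p-k]!
...   | inj₁ p∣k!     = contradiction (prime∣! pp k p∣k!) (ℕ.<⇒≱ k<p)
...   | inj₂ p∣[p-k]! = contradiction (prime∣! pp (p ℕ.∸ k) p∣[p-k]!) (ℕ.<⇒≱ (ℕ.∸-monoʳ-< 0<k (ℕ.<⇒≤ k<p)))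

module Frobenius {a ℓ} (S : CommutativeSemiring a ℓ) where
  open CommutativeSemiring S hiding (zero)
  open Exp semiring using (_^_)
  open Mult semiring using (×-cong; ×-assocˡ) renaming (_×_ to _×ₛ_)
  open CommutativeMult +-commutativeMonoid using (×-distrib-+)
  open Sum semiring using (sum; sum-init-last)
  open import Relation.Binary.Reasoning.Setoid setoid

  sum-multiple : ∀ p {m} (t : Vector Carrier m) → (∀ i → ∃[ z ] t i ≈ p ×ₛ z) → ∃[ z ] sum t ≈ p ×ₛ z
  sum-multiple p {zero}  t h = 0# , sym (×-zero p)
    where
    ×-zero : ∀ p → p ×ₛ 0# ≈ 0#
    ×-zero zero    = refl
    ×-zero (suc p) = trans (+-identityˡ _) (×-zero p)
  sum-multiple p {suc m} t h =
    let z , eq  = h zero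
        w , eq′ = sum-multiple p (tail t) (λ i → h (suc i))
    in z + w , trans (+-cong eq eq′) (sym (×-distrib-+ z w p))

  -- A semiring has no subtraction, so the congruence modulo p is stated with an explicit multiple
  -- of p, which collects the middle binomial terms.
  frobenius : ∀ {p} → Prime p → ∀ x y → ∃[ z ] (x + y) ^ p ≈ (x ^ p + y ^ p) + p ×ₛ z
  frobenius {p@(suc q)} pp x y = z , (begin
    (x + y) ^ p
      ≈⟨ theorem p x y ⟩
    t zero + sum (tail t)
      ≈⟨ +-congˡ (sum-init-last (tail t)) ⟩
    t zero + (sum (init (tail t)) + last (tail t))
      ≈⟨ +-cong first (+-cong eq final) ⟩
    y ^ p + (p ×ₛ z + x ^ p)
      ≈⟨ +-congˡ (+-comm _ _) ⟩
    y ^ p + (x ^ p + p ×ₛ z)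
      ≈⟨ +-assoc _ _ _ ⟨
    (y ^ p + x ^ p) + p ×ₛ z
      ≈⟨ +-congʳ (+-comm _ _) ⟩
    (x ^ p + y ^ p) + p ×ₛ z ∎)
    where
    open Binomial S using (theorem; binomialTerm; binomial)
    t : Vector Carrier (suc p)
    t = binomialTerm x y p
    first : t zero ≈ y ^ p
    first = trans (+-identityʳ _) (*-identityˡ _)
    final : last (tail t) ≈ x ^ p
    final rewrite Fin.toℕ-fromℕ q | nCn≡1 p | ℕ.n∸n≡0 q = trans (+-identityʳ _) (*-identityʳ _)
    middle : ∀ i → ∃[ z ] init (tail t) i ≈ p ×ₛ z
    middle i with prime∣C pp (suc (toℕ (inject₁ i))) (ℕ.s≤s ℕ.z≤n)
                    (ℕ.s≤s (≡.subst (ℕ._< q) (≡.sym (Fin.toℕ-inject₁ i)) (Fin.toℕ<n i)))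
    ... | divides k eq = k ×ₛ b , (begin
      (p C suc (toℕ (inject₁ i))) ×ₛ b   ≈⟨ ×-cong (≡.trans eq (ℕ.*-comm k p)) refl ⟩
      (p ℕ.* k) ×ₛ b                     ≈⟨ ×-assocˡ b p k ⟨
      p ×ₛ (k ×ₛ b)                       ∎)
      where
      b : Carrier
      b = binomial x y p (suc (inject₁ i))
    z : Carrier
    z = proj₁ (sum-multiple p (init (tail t)) middle)
    eq : sum (init (tail t)) ≈ p ×ₛ z
    eq = proj₂ (sum-multiple p (init (tail t)) middle)

open ≡ using (refl; sym; trans; cong; cong₂; subst; subst₂; _≢_; _≗_; module ≡-Reasoning)

-- Lists of exponents as Laurent polynomials in the shift.

module _ where
  open import Data.Integer.Base using (_+_; _*_; _-_; -_; ∣_∣)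

  prime∤⇒coprime : ∀ {p m} → Prime p → ¬ p ℕ.∣ m → Coprime m p
  prime∤⇒coprime pp p∤m (d∣m , d∣p) with prime⇒irreducible pp d∣p
  ... | inj₁ d≡1 = d≡1
  ... | inj₂ refl = contradiction d∣m p∤m

  act : List ℤ → (ℤ → ℤ) → ℤ → ℤ
  act []      g x = + 0
  act (e ∷ L) g x = g (x + e) + act L g x

  act-cong : ∀ L {g h} → g ≗ h → act L g ≗ act L h
  act-cong []      eq x = refl
  act-cong (e ∷ L) eq x = cong₂ _+_ (eq (x + e)) (act-cong L eq x)

  act-0 : ∀ L x → act L (λ _ → + 0) x ≡ + 0
  act-0 []      x = refl
  act-0 (e ∷ L) x = trans (ℤ.+-identityˡ _) (act-0 L x)

  +-interchange : ∀ a b c d → (a + b) + (c + d) ≡ (a + c) + (b + d)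
  +-interchange = solve-∀

  +-swapʳ : ∀ a b c → a + b + c ≡ a + c + b
  +-swapʳ = solve-∀

  act-+ : ∀ L g h x → act L (λ y → g y + h y) x ≡ act L g x + act L h x
  act-+ []      g h x = refl
  act-+ (e ∷ L) g h x = trans (cong (_+_ (g (x + e) + h (x + e))) (act-+ L g h x))
    (+-interchange (g (x + e)) (h (x + e)) (act L g x) (act L h x))

  act-shift : ∀ L e g x → act L (λ y → g (y + e)) x ≡ act L g (x + e)
  act-shift []      e g x = refl
  act-shift (d ∷ L) e g x = cong₂ _+_ (cong g (+-swapʳ x d e)) (act-shift L e g x)

  act-++ : ∀ L M g x → act (L ++ M) g x ≡ act L g x + act M g x
  act-++ []      M g x = sym (ℤ.+-identityˡ _)
  act-++ (e ∷ L) M g x = trans (cong (_+_ (g (x + e))) (act-++ L M g x)) (sym (ℤ.+-assoc (g (x + e)) _ _))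

  act-comm : ∀ L M g x → act L (act M g) x ≡ act M (act L g) x
  act-comm []      M g x = sym (act-0 M x)
  act-comm (e ∷ L) M g x = begin
    act M g (x + e) + act L (act M g) x               ≡⟨ cong₂ _+_ (sym (act-shift M e g x)) (act-comm L M g x) ⟩
    act M (λ y → g (y + e)) x + act M (act L g) x     ≡⟨ act-+ M (λ y → g (y + e)) (act L g) x ⟨
    act M (act (e ∷ L) g) x                           ∎
    where open ≡-Reasoning

  _⊛_ : List ℤ → List ℤ → List ℤ
  []      ⊛ M = []
  (e ∷ L) ⊛ M = map (λ d → e + d) M ++ (L ⊛ M)

  act-map-+ : ∀ e M g x → act (map (λ d → e + d) M) g x ≡ act M g (x + e)
  act-map-+ e []      g x = refl
  act-map-+ e (d ∷ M) g x = cong₂ _+_ (cong g (sym (ℤ.+-assoc x e d))) (act-map-+ e M g x)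

  act-⊛ : ∀ L M g x → act (L ⊛ M) g x ≡ act L (act M g) x
  act-⊛ []      M g x = refl
  act-⊛ (e ∷ L) M g x = trans (act-++ (map (λ d → e + d) M) (L ⊛ M) g x)
    (cong₂ _+_ (act-map-+ e M g x) (act-⊛ L M g x))

  infix 4 _≋_
  record _≋_ (L M : List ℤ) : Set where
    constructor mk≋
    field
      act≡ : ∀ g x → act L g x ≡ act M g x
  open _≋_

  -- A list of exponents stands for the Laurent polynomial in the shift operator
  -- X with these exponents (and multiplicities); two lists are identified when
  -- they act in the same way.
  shiftSemiring : CommutativeSemiring 0ℓ 0ℓ
  shiftSemiring = record
    { Carrier = List ℤ ; _≈_ = _≋_ ; _+_ = _++_ ; _*_ = _⊛_ ; 0# = [] ; 1# = + 0 ∷ []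
    ; isCommutativeSemiring = Biased.isCommutativeSemiringˡ record
      { +-isCommutativeMonoid = Biased.isCommutativeMonoidˡ record
        { isSemigroup = record
          { isMagma = record
            { isEquivalence = ≋-isEquivalence
            ; ∙-cong = λ {L} {L′} {M} {M′} p q → mk≋ λ g x →
                trans (act-++ L M g x) (trans (cong₂ _+_ (act≡ p g x) (act≡ q g x)) (sym (act-++ L′ M′ g x)))
            }
          ; assoc = λ L M N → ≋-reflexive (List.++-assoc L M N)
          }
        ; identityˡ = λ L → mk≋ λ g x → refl
        ; comm = λ L M → mk≋ λ g x →
            trans (act-++ L M g x) (trans (ℤ.+-comm (act L g x) _) (sym (act-++ M L g x)))
        }
      ; *-isCommutativeMonoid = Biased.isCommutativeMonoidˡ record
        { isSemigroup = record
          { isMagma = record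
            { isEquivalence = ≋-isEquivalence
            ; ∙-cong = λ {L} {L′} {M} {M′} p q → mk≋ λ g x →
                trans (act-⊛ L M g x) (trans (act≡ p (act M g) x)
                  (trans (act-cong L′ (act≡ q g) x) (sym (act-⊛ L′ M′ g x))))
            }
          ; assoc = λ L M N → mk≋ λ g x →
              trans (act-⊛ (L ⊛ M) N g x) (trans (act-⊛ L M (act N g) x)
                (sym (trans (act-⊛ L (M ⊛ N) g x) (act-cong L (act-⊛ M N g) x))))
          }
        ; identityˡ = λ L → mk≋ λ g x →
            trans (act-⊛ (+ 0 ∷ []) L g x) (trans (ℤ.+-identityʳ _) (cong (act L g) (ℤ.+-identityʳ x)))
        ; comm = λ L M → mk≋ λ g x →
            trans (act-⊛ L M g x) (trans (act-comm L M g x) (sym (act-⊛ M L g x)))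
        }
      ; distribʳ = λ N L M → mk≋ λ g x →
          trans (act-⊛ (L ++ M) N g x) (trans (act-++ L M (act N g) x)
            (sym (trans (act-++ (L ⊛ N) (M ⊛ N) g x) (cong₂ _+_ (act-⊛ L N g x) (act-⊛ M N g x)))))
      ; zeroˡ = λ L → mk≋ λ g x → refl
      }
    }
    where
    ≋-reflexive : ∀ {L M} → L ≡ M → L ≋ M
    ≋-reflexive refl = mk≋ λ g x → refl
    ≋-isEquivalence : IsEquivalence _≋_
    ≋-isEquivalence = record
      { refl  = mk≋ λ g x → refl
      ; sym   = λ p → mk≋ λ g x → sym (act≡ p g x)
      ; trans = λ p q → mk≋ λ g x → trans (act≡ p g x) (act≡ q g x)
      }

  private
    module S = CommutativeSemiring shiftSemiring
  open Exp S.semiring using (_^_)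
  open Mult S.semiring using () renaming (_×_ to _×ₛ_)

  act-× : ∀ p M g x → act (p ×ₛ M) g x ≡ + p * act M g x
  act-× zero    M g x = refl
  act-× (suc p) M g x = trans (act-++ M (p ×ₛ M) g x)
    (trans (cong (_+_ (act M g x)) (act-× p M g x)) (sym (ℤ.suc-* (+ p) (act M g x))))

  act-^ : ∀ p L g → .{{NonZero p}} → (∀ x → act L g x ≡ + 0) → ∀ x → act (L ^ p) g x ≡ + 0
  act-^ (suc p) L g Lg≡0 x = begin
    act (L ⊛ (L ^ p)) g x      ≡⟨ act-⊛ L (L ^ p) g x ⟩
    act L (act (L ^ p) g) x    ≡⟨ act-comm L (L ^ p) g x ⟩
    act (L ^ p) (act L g) x    ≡⟨ act-cong (L ^ p) Lg≡0 x ⟩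
    act (L ^ p) (λ _ → + 0) x  ≡⟨ act-0 (L ^ p) x ⟩
    + 0                        ∎
    where open ≡-Reasoning

  -- Substitution of Xᵖ for X.
  scale : ℕ → List ℤ → List ℤ
  scale p = map (λ e → + p * e)

  act-monomial-^ : ∀ e p g x → act ((e ∷ []) ^ p) g x ≡ g (x + + p * e)
  act-monomial-^ e zero    g x = trans (ℤ.+-identityʳ _) (cong (λ z → g (x + z)) (sym (ℤ.*-zeroˡ e)))
  act-monomial-^ e (suc p) g x = begin
    act ((e ∷ []) ⊛ ((e ∷ []) ^ p)) g x   ≡⟨ act-⊛ (e ∷ []) ((e ∷ []) ^ p) g x ⟩
    act ((e ∷ []) ^ p) g (x + e) + + 0    ≡⟨ ℤ.+-identityʳ _ ⟩
    act ((e ∷ []) ^ p) g (x + e)          ≡⟨ act-monomial-^ e p g (x + e) ⟩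
    g (x + e + + p * e)                   ≡⟨ cong g (ℤ.+-assoc x e _) ⟩
    g (x + (e + + p * e))                 ≡⟨ cong (λ z → g (x + z)) (ℤ.suc-* (+ p) e) ⟨
    g (x + + suc p * e)                   ∎
    where open ≡-Reasoning

  -- Split off one monomial at a time: its p-th power is exactly Xᵖᵉ, and each splitting contributes
  -- one more multiple of p. The error `M` is found before `g` is given, so it is a polynomial in
  -- the shift.
  act-frobenius : ∀ {p} → Prime p → ∀ L → ∃[ M ] (∀ g x → act (L ^ p) g x ≡ act (scale p L) g x + + p * act M g x)
  act-frobenius {suc p} pp []      = [] , λ g x → sym (trans (ℤ.+-identityˡ _) (ℤ.*-zeroʳ (+ suc p)))
  act-frobenius {p}     pp (e ∷ L) =
    let M , hM  = act-frobenius pp L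
        M′ , hM′ = Frobenius.frobenius shiftSemiring pp (e ∷ []) L
    in M ++ M′ , λ g x → begin
      act ((e ∷ L) ^ p) g x
        ≡⟨ act≡ hM′ g x ⟩
      act ((((e ∷ []) ^ p) ++ (L ^ p)) ++ (p ×ₛ M′)) g x
        ≡⟨ trans (act-++ (((e ∷ []) ^ p) ++ (L ^ p)) (p ×ₛ M′) g x)
             (cong (_+ act (p ×ₛ M′) g x) (act-++ ((e ∷ []) ^ p) (L ^ p) g x)) ⟩
      (act ((e ∷ []) ^ p) g x + act (L ^ p) g x) + act (p ×ₛ M′) g x
        ≡⟨ cong₂ _+_ (cong₂ _+_ (act-monomial-^ e p g x) (hM g x)) (act-× p M′ g x) ⟩
      (g (x + + p * e) + (act (scale p L) g x + + p * act M g x)) + + p * act M′ g x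
        ≡⟨ regroup (g (x + + p * e)) (act (scale p L) g x) (+ p) (act M g x) (act M′ g x) ⟩
      (g (x + + p * e) + act (scale p L) g x) + + p * (act M g x + act M′ g x)
        ≡⟨ cong (λ z → (g (x + + p * e) + act (scale p L) g x) + + p * z) (act-++ M M′ g x) ⟨
      act (scale p (e ∷ L)) g x + + p * act (M ++ M′) g x ∎
    where
    open ≡-Reasoning
    regroup : ∀ a b p c d → (a + (b + p * c)) + p * d ≡ (a + b) + p * (c + d)
    regroup = solve-∀

  -- Bounded functions: from P(X) to P(Xᵏ) for k with large prime factors.

  Bounded : ℕ → (ℤ → ℤ) → Set
  Bounded B g = ∀ x → ∣ g x ∣ ℕ.≤ B

  act-bounded : ∀ {B g} → Bounded B g → ∀ L → Bounded (length L ℕ.* B) (act L g)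
  act-bounded gB []      x = ℕ.z≤n
  act-bounded {B} {g} gB (e ∷ L) x =
    ℕ.≤-trans (ℤ.∣i+j∣≤∣i∣+∣j∣ (g (x + e)) (act L g x)) (ℕ.+-mono-≤ (gB (x + e)) (act-bounded gB L x))

  Annihilates : List ℤ → (ℤ → ℤ) → Set
  Annihilates L g = ∀ x → act L g x ≡ + 0

  -- The value of L(Xᵖ) g is divisible by p and smaller than p.
  annihilates-prime : ∀ {B g} → Bounded B g → ∀ L {p} → Prime p → length L ℕ.* B ℕ.< p →
                      Annihilates L g → Annihilates (scale p L) g
  annihilates-prime {B} {g} gB L {suc p-1} pp small Lg≡0 x with act (scale p L) g x in eq | p∣
    where
    p : ℕ
    p = suc p-1
    M = proj₁ (act-frobenius pp L)
    h : act (scale p L) g x + + p * act M g x ≡ + 0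
    h = trans (sym (proj₂ (act-frobenius pp L) g x)) (act-^ p L g Lg≡0 x)
    p∣ : + p ℤ.∣ act (scale p L) g x
    p∣ = ℤ.∣m+n∣n⇒∣m (subst (+ p ℤ.∣_) (sym h) (ℤ.divides (+ 0) refl)) (ℤ.∣m⇒∣m*n (act M g x) ℤ.∣-refl)
  ... | z | p∣z with ∣ z ∣ in eq′
  ...   | zero  = ℤ.∣i∣≡0⇒i≡0 eq′
  ...   | suc k = contradiction (ℕ.∣⇒≤ (subst (suc p-1 ℕ.∣_) eq′ (ℤ.∣⇒∣ᵤ p∣z)))
                    (ℕ.<⇒≱ (ℕ.≤-<-trans bound small))
    where
    bound : suc k ℕ.≤ length L ℕ.* B
    bound = subst₂ ℕ._≤_ (trans (cong ∣_∣ eq) eq′) (cong (ℕ._* B) (List.length-map _ L))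
      (act-bounded gB (scale (suc p-1) L) x)

  scale-* : ∀ p k L → scale p (scale k L) ≡ scale (p ℕ.* k) L
  scale-* p k []      = refl
  scale-* p k (e ∷ L) = cong₂ _∷_ (trans (sym (ℤ.*-assoc (+ p) (+ k) e)) (cong (_* e) (sym (ℤ.pos-* p k)))) (scale-* p k L)

  scale-1 : ∀ L → scale 1 L ≡ L
  scale-1 []      = refl
  scale-1 (e ∷ L) = cong₂ _∷_ (ℤ.*-identityˡ e) (scale-1 L)

  annihilates-product : ∀ {B g} → Bounded B g → ∀ L {ps} → All Prime ps → All (length L ℕ.* B ℕ.<_) ps →
                        Annihilates L g → Annihilates (scale (product ps) L) g
  annihilates-product {g = g} gB L []  [] Lg≡0 = subst (λ M → Annihilates M g) (sym (scale-1 L)) Lg≡0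
  annihilates-product {B} {g} gB L {p ∷ ps} (pp ∷ pps) (l ∷ ls) Lg≡0 =
    subst (λ M → Annihilates M g) (scale-* p (product ps) L)
      (annihilates-prime gB (scale (product ps) L) pp
        (subst (λ z → z ℕ.* B ℕ.< p) (sym (List.length-map _ L)) l)
        (annihilates-product gB L pps ls Lg≡0))

  -- Its prime factors are exactly the primes up to the second argument that do not divide `a`.
  coprimeProduct : ℕ → ℕ → ℕ
  coprimeProduct a zero    = 1
  coprimeProduct a (suc i) with coprime? a (suc i)
  ... | yes _ = suc i ℕ.* coprimeProduct a i
  ... | no  _ = coprimeProduct a i

  prime∣coprimeProduct : ∀ a B {q} → Prime q → q ℕ.∣ coprimeProduct a B → ¬ q ℕ.∣ a
  prime∣coprimeProduct a zero    pq q∣1 q∣a = contradiction (subst Prime (ℕ.∣1⇒≡1 q∣1) pq) ¬prime[1]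
  prime∣coprimeProduct a (suc i) pq q∣t q∣a with coprime? a (suc i)
  ... | no  _ = prime∣coprimeProduct a i pq q∣t q∣a
  ... | yes c with euclidsLemma (suc i) (coprimeProduct a i) pq q∣t
  ...   | inj₁ q∣1+i = contradiction (subst Prime (c (q∣a , q∣1+i)) pq) ¬prime[1]
  ...   | inj₂ q∣t′  = prime∣coprimeProduct a i pq q∣t′ q∣a

  coprime⇒∣coprimeProduct : ∀ a B {q} → 0 ℕ.< q → q ℕ.≤ B → Coprime a q → q ℕ.∣ coprimeProduct a B
  coprime⇒∣coprimeProduct a zero    0<q q≤0 c = contradiction q≤0 (ℕ.<⇒≱ 0<q)
  coprime⇒∣coprimeProduct a (suc i) {q} 0<q q≤1+i c with coprime? a (suc i) | q ℕ.≟ suc i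
  ... | yes _  | yes refl = ℕ.m∣m*n _
  ... | no  ¬c | yes refl = ⊥-elim (¬c c)
  ... | yes _  | no  q≢   = ℕ.∣n⇒∣m*n (suc i) (coprime⇒∣coprimeProduct a i 0<q (ℕ.≤-pred (ℕ.≤∧≢⇒< q≤1+i q≢)) c)
  ... | no  _  | no  q≢   = coprime⇒∣coprimeProduct a i 0<q (ℕ.≤-pred (ℕ.≤∧≢⇒< q≤1+i q≢)) c

  -- Let t be the `coprimeProduct` and let a prime q ≤ B divide a + N t. If q ∤ a, then q ∣ t, which
  -- forces q ∣ a. If q ∣ a, then q ∣ N t, but q divides neither N, by coprimality, nor t.
  largeFactors : ∀ a N B → Coprime a N → ∀ {q} → Prime q → q ℕ.∣ a ℕ.+ N ℕ.* coprimeProduct a B → B ℕ.< q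
  largeFactors a N B c {q@(suc _)} pq q∣ = ℕ.≰⇒> λ q≤B → case (q ∣? a) q≤B
    where
    case : _ → q ℕ.≤ B → _
    case (no q∤a) q≤B = q∤a (ℕ.∣m+n∣m⇒∣n (subst (q ℕ.∣_) (ℕ.+-comm a _) q∣)
      (ℕ.∣n⇒∣m*n N (coprime⇒∣coprimeProduct a B (ℕ.s≤s ℕ.z≤n) q≤B (prime∤⇒coprime pq q∤a))))
    case (yes q∣a) q≤B with euclidsLemma N (coprimeProduct a B) pq (ℕ.∣m+n∣m⇒∣n q∣ q∣a)
    ... | inj₁ q∣N = contradiction (subst Prime (c (q∣a , q∣N)) pq) ¬prime[1]
    ... | inj₂ q∣t = prime∣coprimeProduct a B pq q∣t q∣a

  -- Periods, and conjugation by exponents coprime to a period.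

  Periodic : ℤ → (ℤ → ℤ) → Set
  Periodic N g = ∀ x → g (x + N) ≡ g x

  periodic-ℕ* : ∀ {N g} → Periodic N g → ∀ k → Periodic (+ k * N) g
  periodic-ℕ* {N} {g} per zero    x = cong g (trans (cong (_+_ x) (ℤ.*-zeroˡ N)) (ℤ.+-identityʳ x))
  periodic-ℕ* {N} {g} per (suc k) x = trans (cong g (lemma x (+ k) N)) (trans (per _) (periodic-ℕ* per k x))
    where
    lemma : ∀ x k N → x + (+ 1 + k) * N ≡ (x + k * N) + N
    lemma = solve-∀

  periodic-* : ∀ {N g} → Periodic N g → ∀ k → Periodic (k * N) g
  periodic-* {N} {g} per (+ k)      x = periodic-ℕ* per k x
  periodic-* {N} {g} per ℤ.-[1+ k ] x = trans (sym (periodic-ℕ* per (suc k) _)) (cong g (lemma x (+ suc k) N))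
    where
    lemma : ∀ x k N → x + (- k) * N + k * N ≡ x
    lemma = solve-∀

  -- On an N-periodic function the substitutions for a and for a + N t agree, and t is chosen so
  -- that every prime factor of a + N t exceeds the bound in `annihilates-prime`. Rescaling changes
  -- neither `g` nor the number of terms, so the same bound serves for each prime in turn.
  annihilates-conjugate : ∀ {B g} → Bounded B g → ∀ L → Annihilates L g → ∀ N → Periodic (+ N) g →
                          ∀ a → .{{NonZero a}} → Coprime a N → Annihilates (scale a L) g
  annihilates-conjugate {B} {g} gB L Lg≡0 N per a@(suc _) c x =
    trans (sym (shift-period L)) (subst (λ k → Annihilates (scale k L) g) (sym isFactorisation)
      (annihilates-product gB L factorsPrime (All.tabulate large) Lg≡0) x)
    where
    t : ℕ
    t = coprimeProduct a (length L ℕ.* B)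
    open PrimeFactorisation (factorise (a ℕ.+ N ℕ.* t))
    large : ∀ {q} → q ∈ factors → length L ℕ.* B ℕ.< q
    large q∈ = largeFactors a N (length L ℕ.* B) c (All.lookup factorsPrime q∈)
      (subst (_ ℕ.∣_) (sym isFactorisation) (∈⇒∣product q∈))
    lemma : ∀ x a N t e → x + (a + N * t) * e ≡ (x + a * e) + (t * e) * N
    lemma = solve-∀
    shift-period : ∀ M → act (scale (a ℕ.+ N ℕ.* t) M) g x ≡ act (scale a M) g x
    shift-period []      = refl
    shift-period (e ∷ M) = cong₂ _+_
      (trans (cong g (trans (cong (λ z → x + z * e) (trans (ℤ.pos-+ a (N ℕ.* t)) (cong (_+_ (+ a)) (ℤ.pos-* N t))))
                        (lemma x (+ a) (+ N) (+ t) e)))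
        (periodic-* per (+ t * e) (x + + a * e)))
      (shift-period M)

  private
    cancel-sub : ∀ a b → (a + b) - b ≡ a
    cancel-sub = solve-∀

    x-y≡0⇒x≡y : ∀ {x y} → x - y ≡ + 0 → x ≡ y
    x-y≡0⇒x≡y {x} {y} = ℤ.i-j≡0⇒i≡j x y

    n*z≡0⇒z≡0 : ∀ n .{{_ : NonZero n}} {z} → + n * z ≡ + 0 → z ≡ + 0
    n*z≡0⇒z≡0 (suc n) eq with inj₂ z≡0 ← ℤ.i*j≡0⇒i≡0∨j≡0 (+ suc n) eq = z≡0

  periodic-+ : ∀ {a b g} → Periodic a g → Periodic b g → Periodic (a + b) g
  periodic-+ {a} {b} {g} pa pb x = trans (cong g (sym (ℤ.+-assoc x a b))) (trans (pb (x + a)) (pa x))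

  periodic-abs : ∀ e {M g} → Periodic (e * M) g → Periodic (+ ∣ e ∣ * M) g
  periodic-abs (+ e)      per = per
  periodic-abs ℤ.-[1+ e ] {M} {g} per = subst (λ z → Periodic z g) (lemma (+ suc e) M) (periodic-* per (- + 1))
    where
    lemma : ∀ e M → - + 1 * (- e * M) ≡ e * M
    lemma = solve-∀

  bézout : ∀ {m n} → Coprime m n → ∃[ k ] ∃[ l ] + 1 ≡ k * + m + l * + n
  bézout {m} {n} c with Coprime.coprime-Bézout c
  ... | Bézout.+- x y eq = + x , - + y , (begin
      + 1                              ≡⟨ cancel-sub (+ 1) (+ y * + n) ⟨
      + 1 + + y * + n - + y * + n      ≡⟨ cong (λ z → + 1 + z - + y * + n) (ℤ.pos-* y n) ⟨
      + (1 ℕ.+ y ℕ.* n) - + y * + n    ≡⟨ cong (λ z → + z - + y * + n) eq ⟩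
      + (x ℕ.* m) - + y * + n          ≡⟨ cong (_- + y * + n) (ℤ.pos-* x m) ⟩
      + x * + m - + y * + n            ≡⟨ lemma (+ x * + m) (+ y) (+ n) ⟩
      + x * + m + - + y * + n          ∎)
    where
    open ≡-Reasoning
    lemma : ∀ a y n → a - y * n ≡ a + - y * n
    lemma = solve-∀
  ... | Bézout.-+ x y eq = - + x , + y , (begin
      + 1                              ≡⟨ cancel-sub (+ 1) (+ x * + m) ⟨
      + 1 + + x * + m - + x * + m      ≡⟨ cong (λ z → + 1 + z - + x * + m) (ℤ.pos-* x m) ⟨
      + (1 ℕ.+ x ℕ.* m) - + x * + m    ≡⟨ cong (λ z → + z - + x * + m) eq ⟩
      + (y ℕ.* n) - + x * + m          ≡⟨ cong (_- + x * + m) (ℤ.pos-* y n) ⟩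
      + y * + n - + x * + m            ≡⟨ lemma (+ y * + n) (+ x) (+ m) ⟩
      - + x * + m + + y * + n          ∎)
    where
    open ≡-Reasoning
    lemma : ∀ a x m → a - x * m ≡ - x * m + a
    lemma = solve-∀

  periodic-coprime : ∀ e p {M g} → Coprime ∣ e ∣ p → Periodic (e * M) g → Periodic (+ p * M) g → Periodic M g
  periodic-coprime e p {M} {g} c pe pp with bézout c
  ... | k , l , eq = subst (λ z → Periodic z g) (begin
      k * (+ ∣ e ∣ * M) + l * (+ p * M)   ≡⟨ lemma k (+ ∣ e ∣) l (+ p) M ⟩
      (k * + ∣ e ∣ + l * + p) * M         ≡⟨ cong (_* M) eq ⟨
      + 1 * M                             ≡⟨ ℤ.*-identityˡ M ⟩
      M                                   ∎)
      (periodic-+ {g = g} (periodic-* (periodic-abs e pe) k) (periodic-* pp l))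
    where
    open ≡-Reasoning
    lemma : ∀ k e l p M → k * (e * M) + l * (p * M) ≡ (k * e + l * p) * M
    lemma = solve-∀

  Δ : ℤ → (ℤ → ℤ) → ℤ → ℤ
  Δ a g x = g (x + a) - g x

  -- Unipotent operators of finite order are trivial: g (x + k a) = g x + k (Δ a g x).
  Δ-periodic⇒periodic : ∀ N .{{_ : NonZero N}} {a g} → Periodic (+ N) g → Periodic a (Δ a g) → Periodic a g
  Δ-periodic⇒periodic N {a} {g} perN perΔ x = x-y≡0⇒x≡y (n*z≡0⇒z≡0 N NΔ≡0)
    where
    open ≡-Reasoning
    linear : ∀ k → g (x + + k * a) ≡ g x + + k * Δ a g x
    linear zero    = trans (cong (λ z → g (x + z)) (ℤ.*-zeroˡ a))
      (trans (cong g (ℤ.+-identityʳ x)) (sym (trans (cong (_+_ (g x)) (ℤ.*-zeroˡ (Δ a g x))) (ℤ.+-identityʳ (g x)))))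
    linear (suc k) = begin
      g (x + + suc k * a)                                   ≡⟨ cong g (lemma₁ x (+ k) a) ⟩
      g (x + + k * a + a)                                   ≡⟨ lemma₂ _ (g (x + + k * a)) ⟩
      Δ a g (x + + k * a) + g (x + + k * a)                 ≡⟨ cong₂ _+_ (periodic-* perΔ (+ k) x) (linear k) ⟩
      Δ a g x + (g x + + k * Δ a g x)                       ≡⟨ lemma₃ (Δ a g x) (g x) (+ k) ⟩
      g x + + suc k * Δ a g x                               ∎
      where
      lemma₁ : ∀ x k a → x + (+ 1 + k) * a ≡ x + k * a + a
      lemma₁ = solve-∀
      lemma₂ : ∀ y z → y ≡ (y - z) + z
      lemma₂ = solve-∀
      lemma₃ : ∀ d g k → d + (g + k * d) ≡ g + (+ 1 + k) * d
      lemma₃ = solve-∀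
    NΔ≡0 : + N * Δ a g x ≡ + 0
    NΔ≡0 = begin
      + N * Δ a g x               ≡⟨ lemma (g x) (+ N * Δ a g x) ⟩
      g x + + N * Δ a g x - g x   ≡⟨ cong (_- g x) (linear N) ⟨
      g (x + + N * a) - g x       ≡⟨ cong (λ z → g (x + z) - g x) (ℤ.*-comm (+ N) a) ⟩
      g (x + a * + N) - g x       ≡⟨ cong (_- g x) (periodic-* perN a x) ⟩
      g x - g x                   ≡⟨ ℤ.+-inverseʳ (g x) ⟩
      + 0                         ∎
      where
      lemma : ∀ y z → z ≡ y + z - y
      lemma = solve-∀

  -- The relation P(Xᵏ) g = 0 written out.

  -- This is P(Xᵏ) g for an integer k, so that k = 1 + s M can be treated as a ring expression;
  -- `act≡form` connects it with the lists of exponents.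
  form : ℤ → ℤ → (ℤ → ℤ) → ℤ → ℤ
  form c k g x = + 2 * g x + (g (x + k) + g (x - k)) + (g (x + k * c) + g (x - k * c))

  exponents : ℤ → List ℤ
  exponents c = + 0 ∷ + 0 ∷ + 1 ∷ - + 1 ∷ c ∷ - c ∷ []

  act≡form : ∀ c k g x → act (scale k (exponents c)) g x ≡ form c (+ k) g x
  act≡form c k g x
    rewrite ℤ.*-zeroʳ (+ k) | ℤ.+-identityʳ x | ℤ.*-identityʳ (+ k)
          | sym (ℤ.neg-distribʳ-* (+ k) (+ 1)) | ℤ.*-identityʳ (+ k) | sym (ℤ.neg-distribʳ-* (+ k) c)
    = lemma (g x) (g (x + + k)) (g (x - + k)) (g (x + + k * c)) (g (x - + k * c))
    where
    lemma : ∀ g a b c d → g + (g + (a + (b + (c + (d + + 0))))) ≡ + 2 * g + (a + b) + (c + d)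
    lemma = solve-∀

  form-bounded : ∀ {B g} c k → Bounded B g → Bounded (6 ℕ.* B) (form c (+ k) g)
  form-bounded {g = g} c k gB x = subst (λ z → ∣ z ∣ ℕ.≤ _) (act≡form c k g x) (act-bounded {g = g} gB (scale k (exponents c)) x)

  form-Δ : ∀ c k a g x → form c k (Δ a g) x ≡ Δ a (form c k g) x
  form-Δ c k a g x
    rewrite +-swapʳ x k a | +-swapʳ x (- k) a | +-swapʳ x (k * c) a | +-swapʳ x (- (k * c)) a
    = regroup (g (x + a)) (g x) (g (x + a + k)) (g (x + k)) (g (x + a - k)) (g (x - k))
        (g (x + a + k * c)) (g (x + k * c)) (g (x + a - k * c)) (g (x - k * c))
    where
    regroup : ∀ a a′ b b′ c c′ d d′ e e′ →
      + 2 * (a - a′) + ((b - b′) + (c - c′)) + ((d - d′) + (e - e′)) ≡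
      (+ 2 * a + (b + c) + (d + e)) - (+ 2 * a′ + (b′ + c′) + (d′ + e′))
    regroup = solve-∀

  form-conjugate : ∀ {B g} c → Bounded B g → (∀ x → form c (+ 1) g x ≡ + 0) → ∀ N → Periodic (+ N) g →
                   ∀ k → .{{NonZero k}} → Coprime k N → ∀ x → form c (+ k) g x ≡ + 0
  form-conjugate {g = g} c gB h N per k cop x = trans (sym (act≡form c k g x))
    (annihilates-conjugate gB (exponents c) (λ y → trans (cong (λ L → act L g y) (sym (scale-1 (exponents c))))
      (trans (act≡form c 1 g y) (h y))) N per k cop x)

  -- Sums over s of the relations for k = 1 + s M.

  sumTo : ℕ → (ℕ → ℤ) → ℤ
  sumTo zero    a = + 0
  sumTo (suc n) a = sumTo n a + a n

  sumTo-cong : ∀ n {a b} → a ≗ b → sumTo n a ≡ sumTo n b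
  sumTo-cong zero    eq = refl
  sumTo-cong (suc n) eq = cong₂ _+_ (sumTo-cong n eq) (eq n)

  sumTo-zero : ∀ n {a} → (∀ s → s ℕ.< n → a s ≡ + 0) → sumTo n a ≡ + 0
  sumTo-zero zero    h = refl
  sumTo-zero (suc n) h = cong₂ _+_ (sumTo-zero n (λ s s<n → h s (ℕ.m≤n⇒m≤1+n s<n))) (h n ℕ.≤-refl)

  sumTo-+ : ∀ n a b → sumTo n (λ s → a s + b s) ≡ sumTo n a + sumTo n b
  sumTo-+ zero    a b = refl
  sumTo-+ (suc n) a b = trans (cong (_+ (a n + b n)) (sumTo-+ n a b)) (+-interchange (sumTo n a) (sumTo n b) (a n) (b n))

  sumTo-Δ : ∀ n a b → sumTo n (λ s → a s - b s) ≡ sumTo n a - sumTo n b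
  sumTo-Δ zero    a b = refl
  sumTo-Δ (suc n) a b = trans (cong (_+ (a n - b n)) (sumTo-Δ n a b)) (lemma (sumTo n a) (sumTo n b) (a n) (b n))
    where
    lemma : ∀ s t a b → (s - t) + (a - b) ≡ (s + a) - (t + b)
    lemma = solve-∀

  sumTo-const : ∀ n z → sumTo n (λ _ → z) ≡ + n * z
  sumTo-const zero    z = sym (ℤ.*-zeroˡ z)
  sumTo-const (suc n) z = trans (cong (_+ z) (sumTo-const n z)) (lemma (+ n) z)
    where
    lemma : ∀ n z → n * z + z ≡ (+ 1 + n) * z
    lemma = solve-∀

  sumTo-telescope : ∀ n (a : ℕ → ℤ) → sumTo n (λ s → a (suc s) - a s) ≡ a n - a 0
  sumTo-telescope zero    a = sym (ℤ.+-inverseʳ (a 0))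
  sumTo-telescope (suc n) a = trans (cong (_+ (a (suc n) - a n)) (sumTo-telescope n a)) (lemma (a n) (a 0) (a (suc n)))
    where
    lemma : ∀ x y z → (x - y) + (z - x) ≡ z - y
    lemma = solve-∀

  -- Of any two summands one vanishes, so at most one survives and the bound does not grow with `n`.
  -- The survivor will be the relation whose exponent is divisible by p.
  sumTo-bounded : ∀ B n a → (∀ s → ∣ a s ∣ ℕ.≤ B) → (∀ {s s′} → s ℕ.< s′ → s′ ℕ.< n → a s ≡ + 0 ⊎ a s′ ≡ + 0) →
                  ∣ sumTo n a ∣ ℕ.≤ B
  sumTo-bounded B zero    a aB h = ℕ.z≤n
  sumTo-bounded B (suc n) a aB h with a n ℤ.≟ + 0
  ... | yes an≡0 = subst (λ z → ∣ z ∣ ℕ.≤ B) (sym (trans (cong (_+_ (sumTo n a)) an≡0) (ℤ.+-identityʳ (sumTo n a))))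
                     (sumTo-bounded B n a aB (λ s<s′ s′<n → h s<s′ (ℕ.m≤n⇒m≤1+n s′<n)))
  ... | no  an≢0 = subst (λ z → ∣ z ∣ ℕ.≤ B) (sym (trans (cong (_+ a n) (sumTo-zero n earlier)) (ℤ.+-identityˡ (a n)))) (aB n)
    where
    earlier : ∀ s → s ℕ.< n → a s ≡ + 0
    earlier s s<n with h s<n ℕ.≤-refl
    ... | inj₁ as≡0 = as≡0
    ... | inj₂ an≡0 = contradiction an≡0 an≢0

  -- The sum S of `g` along p steps of length e M has period e M, because the telescoped difference
  -- is a shift by e p M, and it inherits the period p M. As e and p are coprime, S has period M,
  -- and the sum in question is S (y + M) - S y.
  sum-progression-Δ : ∀ e p M {g} → Coprime ∣ e ∣ p → Periodic (+ p * M) g → ∀ y →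
                      sumTo p (λ s → Δ M g (y + + s * (e * M))) ≡ + 0
  sum-progression-Δ e p M {g} cop per y = begin
    sumTo p (λ s → Δ M g (y + + s * E))                                   ≡⟨ sumTo-Δ p (λ s → g (y + + s * E + M)) (λ s → g (y + + s * E)) ⟩
    sumTo p (λ s → g (y + + s * E + M)) - S y                             ≡⟨ cong (_- S y) (sumTo-cong p (λ s → cong g (+-swapʳ y (+ s * E) M))) ⟩
    S (y + M) - S y                                                       ≡⟨ cong (_- S y) (periodic-coprime e p cop perE (perS) y) ⟩
    S y - S y                                                             ≡⟨ ℤ.+-inverseʳ (S y) ⟩
    + 0                                                                   ∎
    where
    open ≡-Reasoning
    E : ℤ
    E = e * M
    S : ℤ → ℤ
    S z = sumTo p (λ s → g (z + + s * E))
    perS : Periodic (+ p * M) S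
    perS z = sumTo-cong p λ s → trans (cong g (sym (+-swapʳ z (+ s * E) (+ p * M)))) (per (z + + s * E))
    perE : Periodic (e * M) S
    perE z = x-y≡0⇒x≡y (begin
      S (z + E) - S z
        ≡⟨ sumTo-Δ p (λ s → g (z + E + + s * E)) (λ s → g (z + + s * E)) ⟨
      sumTo p (λ s → g (z + E + + s * E) - g (z + + s * E))
        ≡⟨ sumTo-cong p (λ s → cong (λ w → g w - g (z + + s * E)) (next z E (+ s))) ⟩
      sumTo p (λ s → g (z + + suc s * E) - g (z + + s * E))
        ≡⟨ sumTo-telescope p (λ s → g (z + + s * E)) ⟩
      g (z + + p * (e * M)) - g (z + + 0 * E)
        ≡⟨ cong₂ (λ a b → g a - g b) (cong (_+_ z) (reorder (+ p) e M)) (trans (cong (_+_ z) (ℤ.*-zeroˡ E)) (ℤ.+-identityʳ z)) ⟩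
      g (z + e * (+ p * M)) - g z
        ≡⟨ cong (_- g z) (periodic-* per e z) ⟩
      g z - g z
        ≡⟨ ℤ.+-inverseʳ (g z) ⟩
      + 0 ∎)
      where
      next : ∀ z E s → z + E + s * E ≡ z + (+ 1 + s) * E
      next = solve-∀
      reorder : ∀ p e M → p * (e * M) ≡ e * (p * M)
      reorder = solve-∀

  -- Σ_s form c (1 + s M) (Δ M g): every non-constant term runs over a full orbit
  -- of the shift by M, so only the constant terms survive.
  sum-form-Δ : ∀ c p M {g} → Coprime c p → Periodic (+ p * M) g → ∀ x →
               sumTo p (λ s → form (+ c) (+ 1 + + s * M) (Δ M g) x) ≡ + p * (+ 2 * Δ M g x)
  sum-form-Δ c p M {g} cop per x = begin
    sumTo p (λ s → form (+ c) (+ 1 + + s * M) u x)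
      ≡⟨ sumTo-cong p (λ s → cong₂ _+_ (cong (_+_ (+ 2 * u x)) (cong₂ _+_
           (cong u (e₁ x (+ s) M)) (cong u (e₂ x (+ s) M)))) (cong₂ _+_
           (cong u (e₃ x (+ s) M (+ c))) (cong u (e₄ x (+ s) M (+ c))))) ⟩
    sumTo p (λ s → + 2 * u x + (a₁ s + a₂ s) + (a₃ s + a₄ s))
      ≡⟨ sumTo-+ p (λ s → + 2 * u x + (a₁ s + a₂ s)) (λ s → a₃ s + a₄ s) ⟩
    sumTo p (λ s → + 2 * u x + (a₁ s + a₂ s)) + sumTo p (λ s → a₃ s + a₄ s)
      ≡⟨ cong₂ _+_ (sumTo-+ p (λ _ → + 2 * u x) (λ s → a₁ s + a₂ s)) (sumTo-+ p a₃ a₄) ⟩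
    sumTo p (λ _ → + 2 * u x) + sumTo p (λ s → a₁ s + a₂ s) + (sumTo p a₃ + sumTo p a₄)
      ≡⟨ cong₂ (λ y z → y + z + (sumTo p a₃ + sumTo p a₄)) (sumTo-const p (+ 2 * u x)) (sumTo-+ p a₁ a₂) ⟩
    + p * (+ 2 * u x) + (sumTo p a₁ + sumTo p a₂) + (sumTo p a₃ + sumTo p a₄)
      ≡⟨ cong₂ (λ y z → + p * (+ 2 * u x) + y + z)
           (cong₂ _+_ (sum-progression-Δ (+ 1) p M (Coprime.1-coprimeTo p) per (x + + 1))
                      (sum-progression-Δ (- + 1) p M (Coprime.1-coprimeTo p) per (x - + 1)))
           (cong₂ _+_ (sum-progression-Δ (+ c) p M cop per (x + + c))
                      (sum-progression-Δ (- + c) p M (subst (λ z → Coprime z p) (sym (ℤ.∣-i∣≡∣i∣ (+ c))) cop) per (x - + c))) ⟩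
    + p * (+ 2 * u x) + + 0 + + 0
      ≡⟨ trans (ℤ.+-identityʳ _) (ℤ.+-identityʳ _) ⟩
    + p * (+ 2 * u x) ∎
    where
    open ≡-Reasoning
    u = Δ M g
    a₁ a₂ a₃ a₄ : ℕ → ℤ
    a₁ s = u (x + + 1 + + s * (+ 1 * M))
    a₂ s = u (x - + 1 + + s * (- + 1 * M))
    a₃ s = u (x + + c + + s * (+ c * M))
    a₄ s = u (x - + c + + s * (- + c * M))
    e₁ : ∀ x s M → x + (+ 1 + s * M) ≡ x + + 1 + s * (+ 1 * M)
    e₁ = solve-∀
    e₂ : ∀ x s M → x - (+ 1 + s * M) ≡ x - + 1 + s * (- + 1 * M)
    e₂ = solve-∀
    e₃ : ∀ x s M c → x + (+ 1 + s * M) * c ≡ x + c + s * (c * M)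
    e₃ = solve-∀
    e₄ : ∀ x s M c → x - (+ 1 + s * M) * c ≡ x - c + s * (- c * M)
    e₄ = solve-∀

  -- Dividing odd primes out of a period.

  -- The hypothesis improves a bound B to 6 B / (2 p) ≤ 3 B / 5. Values are integers, so a positive
  -- bound drops by at least one each time and reaches 0.
  contraction⇒zero : ∀ p → 5 ℕ.≤ p → ∀ u → (∀ B → Bounded B u → ∀ x → p ℕ.* (2 ℕ.* ∣ u x ∣) ℕ.≤ 6 ℕ.* B) →
                     ∀ B → Bounded B u → ∀ x → u x ≡ + 0
  contraction⇒zero p 5≤p u h zero    uB x = ℤ.∣i∣≡0⇒i≡0 (ℕ.n≤0⇒n≡0 (uB x))
  contraction⇒zero p 5≤p u h (suc B) uB = contraction⇒zero p 5≤p u h B λ x → ℕ.≤-pred (ℕ.≰⇒> λ 1+B≤∣ux∣ →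
    ℕ.<⇒≱ (begin-strict
      6 ℕ.* suc B                <⟨ ℕ.*-monoˡ-< (suc B) {6} {10} (ℕ.m≤n+m 7 3) ⟩
      10 ℕ.* suc B               ≡⟨ ℕ.*-assoc 5 2 (suc B) ⟩
      5 ℕ.* (2 ℕ.* suc B)        ≤⟨ ℕ.*-mono-≤ 5≤p (ℕ.*-monoʳ-≤ 2 1+B≤∣ux∣) ⟩
      p ℕ.* (2 ℕ.* ∣ u x ∣)      ∎) (h (suc B) uB x))
    where open ℕ.≤-Reasoning

  prime≥5 : ∀ {p} → Prime p → p ≢ 2 → p ≢ 3 → 5 ℕ.≤ p
  prime≥5 {0} pp _ _ = contradiction pp ¬prime[0]
  prime≥5 {1} pp _ _ = contradiction pp ¬prime[1]
  prime≥5 {2} pp p≢2 _ = contradiction refl p≢2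
  prime≥5 {3} pp _ p≢3 = contradiction refl p≢3
  prime≥5 {4} pp _ _ = contradiction pp (composite⇒¬prime composite[4])
  prime≥5 {suc (suc (suc (suc (suc p))))} pp _ _ = ℕ.s≤s (ℕ.s≤s (ℕ.s≤s (ℕ.s≤s (ℕ.s≤s ℕ.z≤n))))

  coprime-1+s*M : ∀ {p} → Prime p → ∀ M s → ¬ p ℕ.∣ 1 ℕ.+ s ℕ.* M → Coprime (1 ℕ.+ s ℕ.* M) (p ℕ.* M)
  coprime-1+s*M {p} pp M s p∤ {d} (d∣ , d∣pM) = ℕ.∣1⇒≡1 (ℕ.∣m+n∣m⇒∣n (subst (d ℕ.∣_) (ℕ.+-comm 1 _) d∣) (ℕ.∣n⇒∣m*n s d∣M))
    where
    d∣M : d ℕ.∣ M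
    d∣M = Coprime.coprime-divisor (λ (e∣d , e∣p) → prime∤⇒coprime pp p∤ (ℕ.∣-trans e∣d d∣ , e∣p)) d∣pM

  -- From p ∣ 1 + s M it follows that p ∤ M, so the s for which p divides 1 + s M lie in one residue
  -- class modulo p.
  prime∣difference : ∀ {p} → Prime p → ∀ M s i → p ℕ.∣ 1 ℕ.+ s ℕ.* M → p ℕ.∣ 1 ℕ.+ (s ℕ.+ i) ℕ.* M → p ℕ.∣ i
  prime∣difference {p} pp M s i p∣₁ p∣₂ with euclidsLemma i M pp
    (ℕ.∣m+n∣m⇒∣n (subst (p ℕ.∣_) (cong suc (ℕ.*-distribʳ-+ M s i)) p∣₂) p∣₁)
  ... | inj₁ p∣i = p∣i
  ... | inj₂ p∣M = contradiction (subst Prime (ℕ.∣1⇒≡1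
          (ℕ.∣m+n∣m⇒∣n (subst (p ℕ.∣_) (ℕ.+-comm 1 _) p∣₁) (ℕ.∣n⇒∣m*n s p∣M))) pp) ¬prime[1]

  -- If some s in {0, 1, 2} is bad, the next three are good, because bad values differ by multiples
  -- of p ≥ 5. Three consecutive good values give the two differences of relations used in
  -- `strip-∣`.
  threeUnits : ∀ {p} → Prime p → 5 ℕ.≤ p → ∀ M → ∃[ s ] (∀ i → i ℕ.< 3 → ¬ p ℕ.∣ 1 ℕ.+ (s ℕ.+ i) ℕ.* M)
  threeUnits {p} pp 5≤p M = search (p ∣? _) (p ∣? _) (p ∣? _)
    where
    after : ∀ s → p ℕ.∣ 1 ℕ.+ s ℕ.* M → ∃[ s ] (∀ i → i ℕ.< 3 → ¬ p ℕ.∣ 1 ℕ.+ (s ℕ.+ i) ℕ.* M)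
    after s p∣ = suc s , λ i i<3 p∣′ → ℕ.<⇒≱ (ℕ.<-≤-trans (ℕ.s≤s i<3) (ℕ.≤-trans (ℕ.n≤1+n 4) 5≤p))
      (ℕ.∣⇒≤ (prime∣difference pp M s (suc i) p∣ (subst (λ z → p ℕ.∣ 1 ℕ.+ z ℕ.* M) (sym (ℕ.+-suc s i)) p∣′)))
    search : _ → _ → _ → _
    search (yes p∣) _ _ = after 0 p∣
    search _ (yes p∣) _ = after 1 p∣
    search _ _ (yes p∣) = after 2 p∣
    search (no p∤₀) (no p∤₁) (no p∤₂) = 0 , λ
      { 0 _ → p∤₀ ; 1 _ → p∤₁ ; 2 _ → p∤₂ ; (suc (suc (suc _))) (ℕ.s≤s (ℕ.s≤s (ℕ.s≤s ()))) }

  module Descent {B g} (c : ℕ) (gB : Bounded B g) (form≡0 : ∀ x → form (+ c) (+ 1) g x ≡ + 0) where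

    pos-1+s*M : ∀ s M → + (1 ℕ.+ s ℕ.* M) ≡ + 1 + + s * + M
    pos-1+s*M s M = cong (_+_ (+ 1)) (ℤ.pos-* s M)

    conjugate : ∀ {p} → Prime p → ∀ M → Periodic (+ p * + M) g → ∀ s → ¬ p ℕ.∣ 1 ℕ.+ s ℕ.* M →
                ∀ x → form (+ c) (+ 1 + + s * + M) g x ≡ + 0
    conjugate {p} pp M per s p∤ x = subst (λ k → form (+ c) k g x ≡ + 0) (pos-1+s*M s M)
      (form-conjugate (+ c) gB form≡0 (p ℕ.* M) (subst (λ N → Periodic N g) (sym (ℤ.pos-* p M)) per)
        (1 ℕ.+ s ℕ.* M) (coprime-1+s*M pp M s p∤) x)

    -- When p divides c, only the terms g (x ± k) of the relation for k = 1 + s M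
    -- depend on s; with Z the shift by M, comparing consecutive s gives
    -- (X²ᵏ⁺ᴹ - 1)(Z - 1) g = 0 and (X²ᵏ⁺³ᴹ - 1)(Z - 1) g = 0, so Z² fixes (Z - 1) g.
    strip-∣ : ∀ {p} → Prime p → 5 ℕ.≤ p → p ℕ.∣ c → ∀ M → .{{NonZero M}} →
              Periodic (+ p * + M) g → Periodic (+ M) g
    strip-∣ {p} pp 5≤p (divides q c≡q*p) M per with threeUnits pp 5≤p M
    ... | s₀ , units =
      -- The periods of `d` for i = 1 and i = 0 differ by 2 M. Together with the period p M, p odd,
      -- this gives `d` the period M, and then `g` as well, since the shift by M has finite order.
      Δ-periodic⇒periodic (p ℕ.* M) {{ℕ.m*n≢0 p M {{prime⇒nonZero pp}}}} (subst (λ N → Periodic N g) (sym (ℤ.pos-* p M)) per)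
        (periodic-coprime (+ 2) p {Z} (prime∤⇒coprime pp (λ p∣2 → ℕ.<⇒≱ (ℕ.≤-trans (ℕ.m≤n+m 3 2) 5≤p) (ℕ.∣⇒≤ p∣2)))
          (subst (λ z → Periodic z d) (difference A Z)
            (periodic-+ {g = d} (d-periodic 1 (ℕ.s≤s (ℕ.s≤s (ℕ.s≤s ℕ.z≤n))))
              (periodic-* {g = d} (d-periodic 0 (ℕ.s≤s (ℕ.s≤s ℕ.z≤n))) (- + 1))))
          λ x → cong₂ _-_ (trans (cong g (+-swapʳ x (+ p * Z) Z)) (per (x + Z))) (per x))
      where
      Z A : ℤ
      Z = + M
      A = + 1 + + s₀ * Z
      d : ℤ → ℤ
      d = Δ Z g
      k : ℕ → ℤ
      k i = A + + i * Z
      difference : ∀ A Z → (+ 2 * A + (+ 2 * + 1 + + 1) * Z) + - + 1 * (+ 2 * A + (+ 2 * + 0 + + 1) * Z) ≡ + 2 * Z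
      difference = solve-∀
      relation : ∀ i → i ℕ.< 3 → ∀ x → form (+ c) (k i) g x ≡ + 0
      relation i i<3 x = subst (λ k → form (+ c) k g x ≡ + 0)
        (trans (cong (λ z → + 1 + z * Z) (ℤ.pos-+ s₀ i)) (lemma (+ s₀) (+ i) Z))
        (conjugate pp M per (s₀ ℕ.+ i) (units i i<3) x)
        where
        lemma : ∀ s i Z → + 1 + (s + i) * Z ≡ + 1 + s * Z + i * Z
        lemma = solve-∀
      rest : ℤ → ℤ
      rest x = + 2 * g x + (g (x + A * + c) + g (x - A * + c))
      pair : ∀ i → i ℕ.< 3 → ∀ x → g (x + k i) + g (x - k i) ≡ - rest x
      pair i i<3 x = begin
        g (x + k i) + g (x - k i)
          ≡⟨ lemma₁ (+ 2 * g x) (g (x + k i) + g (x - k i)) (g (x + k i * + c) + g (x - k i * + c)) ⟩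
        form (+ c) (k i) g x - (+ 2 * g x + (g (x + k i * + c) + g (x - k i * + c)))
          ≡⟨ cong₂ (λ y z → y - (+ 2 * g x + z)) (relation i i<3 x) (cong₂ _+_ (reduce₁ x) (reduce₂ x)) ⟩
        + 0 - rest x
          ≡⟨ ℤ.+-identityˡ _ ⟩
        - rest x ∎
        where
        open ≡-Reasoning
        lemma₁ : ∀ a b c → b ≡ (a + b + c) - (a + c)
        lemma₁ = solve-∀
        c≡ : + c ≡ + q * + p
        c≡ = trans (cong +_ c≡q*p) (ℤ.pos-* q p)
        lemma₂ : ∀ x A i q p Z → x + (A + i * Z) * (q * p) ≡ x + A * (q * p) + (i * q) * (p * Z)
        lemma₂ = solve-∀
        reduce₁ : ∀ x → g (x + k i * + c) ≡ g (x + A * + c)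
        reduce₁ x = subst (λ C → g (x + k i * C) ≡ g (x + A * C)) (sym c≡)
          (trans (cong g (lemma₂ x A (+ i) (+ q) (+ p) Z)) (periodic-* per (+ i * + q) (x + A * (+ q * + p))))
        lemma₃ : ∀ x A i q p Z → x - (A + i * Z) * (q * p) ≡ x - A * (q * p) + (- (i * q)) * (p * Z)
        lemma₃ = solve-∀
        reduce₂ : ∀ x → g (x - k i * + c) ≡ g (x - A * + c)
        reduce₂ x = subst (λ C → g (x - k i * C) ≡ g (x - A * C)) (sym c≡)
          (trans (cong g (lemma₃ x A (+ i) (+ q) (+ p) Z)) (periodic-* per (- (+ i * + q)) (x - A * (+ q * + p))))
      d-periodic : ∀ i → suc i ℕ.< 3 → Periodic (+ 2 * A + (+ 2 * + i + + 1) * Z) d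
      d-periodic i 1+i<3 x = begin
        g (x + P + Z) - g (x + P)
          ≡⟨ lemma (g (x + P + Z)) (g x) (g (x + P)) (g (x + Z)) ⟩
        (g (x + P + Z) + g x) - (g (x + P) + g (x + Z)) + d x
          ≡⟨ cong (λ z → z - (g (x + P) + g (x + Z)) + d x) sums-equal ⟩
        (g (x + P) + g (x + Z)) - (g (x + P) + g (x + Z)) + d x
          ≡⟨ cong (_+ d x) (ℤ.+-inverseʳ (g (x + P) + g (x + Z))) ⟩
        + 0 + d x
          ≡⟨ ℤ.+-identityˡ (d x) ⟩
        d x ∎
        where
        open ≡-Reasoning
        P y : ℤ
        P = + 2 * A + (+ 2 * + i + + 1) * Z
        -- Centred at y, the backward arguments y - k (suc i) and y - k i become x and x + Z, and
        -- the forward ones x + P + Z and x + P, with P = k i + k (suc i).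
        y = x + k (suc i)
        lemma : ∀ a b c e → a - c ≡ (a + b) - (c + e) + (e - b)
        lemma = solve-∀
        e₁ : ∀ x A i Z → x + (A + (+ 1 + i) * Z) + (A + (+ 1 + i) * Z) ≡ x + (+ 2 * A + (+ 2 * i + + 1) * Z) + Z
        e₁ = solve-∀
        e₂ : ∀ x k → x + k - k ≡ x
        e₂ = solve-∀
        e₃ : ∀ x A i Z → x + (A + (+ 1 + i) * Z) + (A + i * Z) ≡ x + (+ 2 * A + (+ 2 * i + + 1) * Z)
        e₃ = solve-∀
        e₄ : ∀ x A i Z → x + (A + (+ 1 + i) * Z) - (A + i * Z) ≡ x + Z
        e₄ = solve-∀
        sums-equal : g (x + P + Z) + g x ≡ g (x + P) + g (x + Z)
        sums-equal = begin
          g (x + P + Z) + g x                   ≡⟨ cong₂ (λ a b → g a + g b) (e₁ x A (+ i) Z) (e₂ x (k (suc i))) ⟨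
          g (y + k (suc i)) + g (y - k (suc i)) ≡⟨ pair (suc i) 1+i<3 y ⟩
          - rest y                              ≡⟨ pair i (ℕ.<-trans (ℕ.n<1+n i) 1+i<3) y ⟨
          g (y + k i) + g (y - k i)             ≡⟨ cong₂ (λ a b → g a + g b) (e₃ x A (+ i) Z) (e₄ x A (+ i) Z) ⟩
          g (x + P) + g (x + Z)                 ∎

    -- By `sum-form-Δ` the relations for `u` sum to 2 p u. If p ∣ M, every exponent 1 + s M is prime
    -- to p, so the sum is 0. If p ≥ 5, at most one summand is nonzero and the bound on `u`
    -- contracts.
    strip-∤ : ∀ {p} → Prime p → ¬ p ℕ.∣ c → ∀ M → (p ℕ.∣ M ⊎ 5 ℕ.≤ p) →
              Periodic (+ p * + M) g → Periodic (+ M) g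
    strip-∤ {p} pp p∤c M cases per x = x-y≡0⇒x≡y (u≡0 cases x)
      where
      u : ℤ → ℤ
      u = Δ (+ M) g
      term : ℤ → ℕ → ℤ
      term x s = form (+ c) (+ 1 + + s * + M) u x
      good : ∀ x s → ¬ p ℕ.∣ 1 ℕ.+ s ℕ.* M → term x s ≡ + 0
      good x s p∤ = trans (form-Δ (+ c) (+ 1 + + s * + M) (+ M) g x)
        (cong₂ _-_ (conjugate pp M per s p∤ (x + + M)) (conjugate pp M per s p∤ x))
      total : ∀ x → sumTo p (term x) ≡ + p * (+ 2 * u x)
      total = sum-form-Δ c p (+ M) (prime∤⇒coprime pp p∤c) per
      uB : Bounded (B ℕ.+ B) u
      uB x = ℕ.≤-trans (ℤ.∣i-j∣≤∣i∣+∣j∣ (g (x + + M)) (g x)) (ℕ.+-mono-≤ (gB (x + + M)) (gB x))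
      almostAllZero : ∀ x {s s′} → s ℕ.< s′ → s′ ℕ.< p → term x s ≡ + 0 ⊎ term x s′ ≡ + 0
      almostAllZero x {s} {s′} s<s′ s′<p with p ∣? 1 ℕ.+ s ℕ.* M | p ∣? 1 ℕ.+ s′ ℕ.* M
      ... | no p∤  | _      = inj₁ (good x s p∤)
      ... | yes _  | no p∤  = inj₂ (good x s′ p∤)
      ... | yes p∣ | yes p∣′ = contradiction
        (ℕ.∣⇒≤ {{ℕ.>-nonZero (ℕ.m<n⇒0<n∸m s<s′)}} (prime∣difference pp M s (s′ ℕ.∸ s) p∣
          (subst (λ z → p ℕ.∣ 1 ℕ.+ z ℕ.* M) (sym (ℕ.m+[n∸m]≡n (ℕ.<⇒≤ s<s′))) p∣′)))
        (ℕ.<⇒≱ (ℕ.≤-<-trans (ℕ.m∸n≤m s′ s) s′<p))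
      contracts : ∀ B′ → Bounded B′ u → ∀ x → p ℕ.* (2 ℕ.* ∣ u x ∣) ℕ.≤ 6 ℕ.* B′
      contracts B′ uB′ x = subst (ℕ._≤ 6 ℕ.* B′)
        (trans (cong ∣_∣ (total x)) (trans (ℤ.abs-* (+ p) (+ 2 * u x)) (cong (p ℕ.*_) (ℤ.abs-* (+ 2) (u x)))))
        (sumTo-bounded (6 ℕ.* B′) p (term x)
          (λ s → subst (λ k → ∣ form (+ c) k u x ∣ ℕ.≤ 6 ℕ.* B′) (pos-1+s*M s M) (form-bounded {g = u} (+ c) (1 ℕ.+ s ℕ.* M) uB′ x))
          (almostAllZero x))
      u≡0 : p ℕ.∣ M ⊎ 5 ℕ.≤ p → ∀ x → u x ≡ + 0
      u≡0 (inj₂ 5≤p) x = contraction⇒zero p 5≤p u contracts (B ℕ.+ B) uB x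
      u≡0 (inj₁ p∣M) x = n*z≡0⇒z≡0 2 (n*z≡0⇒z≡0 p {{prime⇒nonZero pp}} (trans (sym (total x))
        (sumTo-zero p λ s _ → good x s λ p∣ → ¬prime[1] (subst Prime
          (ℕ.∣1⇒≡1 (ℕ.∣m+n∣m⇒∣n (subst (p ℕ.∣_) (ℕ.+-comm 1 _) p∣) (ℕ.∣n⇒∣m*n s p∣M))) pp))))

    -- Keeping 3 ∣ M confines p = 3 to the middle case: 3 ∤ c rules out the first, and 3 ∣ M the
    -- last. Every other odd prime is at least 5.
    strip : ¬ 3 ℕ.∣ c → ∀ {p} → Prime p → p ≢ 2 → ∀ M → .{{NonZero M}} → 3 ℕ.∣ M →
            Periodic (+ p * + M) g → Periodic (+ M) g
    strip 3∤c {p} pp p≢2 M 3∣M per with p ∣? c | p ∣? M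
    ... | yes p∣c | _       = strip-∣ pp (prime≥5 pp p≢2 λ { refl → 3∤c p∣c }) p∣c M per
    ... | no  p∤c | yes p∣M = strip-∤ pp p∤c M (inj₁ p∣M) per
    ... | no  p∤c | no  p∤M = strip-∤ pp p∤c M (inj₂ (prime≥5 pp p≢2 λ { refl → p∤M 3∣M })) per

    -- Factors 2 are moved from the list into `2 ^ a`, and all other primes are divided out. The
    -- explicit factor 3 is never touched and supplies 3 ∣ M at each step.
    stripAll : ¬ 3 ℕ.∣ c → ∀ a {ps} → All Prime ps → Periodic (+ (2 ℕ.^ a ℕ.* 3 ℕ.* product ps)) g →
               ∃[ b ] Periodic (+ (2 ℕ.^ b ℕ.* 3)) g
    stripAll 3∤c a {[]} [] per = a , subst (λ N → Periodic (+ N) g) (ℕ.*-identityʳ _) per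
    stripAll 3∤c a {p ∷ ps} (pp ∷ pps) per with p ℕ.≟ 2
    ... | yes refl = stripAll 3∤c (suc a) pps (subst (λ N → Periodic (+ N) g) (lemma (2 ℕ.^ a) (product ps)) per)
      where
      lemma : ∀ x y → x ℕ.* 3 ℕ.* (2 ℕ.* y) ≡ 2 ℕ.* x ℕ.* 3 ℕ.* y
      lemma = ℕ-solve-∀
    ... | no p≢2 = stripAll 3∤c a pps (strip 3∤c pp p≢2 M {{M≢0}} (ℕ.∣m⇒∣m*n (product ps) (ℕ.n∣m*n (2 ℕ.^ a)))
        (subst (λ N → Periodic N g) (trans (cong +_ (lemma (2 ℕ.^ a ℕ.* 3) p (product ps))) (ℤ.pos-* p M)) per))
      where
      M : ℕ
      M = 2 ℕ.^ a ℕ.* 3 ℕ.* product ps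
      M≢0 : NonZero M
      M≢0 = ℕ.m*n≢0 (2 ℕ.^ a ℕ.* 3) (product ps) {{ℕ.m*n≢0 (2 ℕ.^ a) 3 {{ℕ.m^n≢0 2 a}}}} {{productOfPrimes≢0 pps}}
      lemma : ∀ x p y → x ℕ.* (p ℕ.* y) ≡ p ℕ.* (x ℕ.* y)
      lemma = ℕ-solve-∀

  -- From the magic relation to a period of the labelling.

  antiperiodic⇒periodic : ∀ {a g} → (∀ x → g (x + a) ≡ - g x) → Periodic (+ 2 * a) g
  antiperiodic⇒periodic {a} {g} anti x = begin
    g (x + + 2 * a)  ≡⟨ cong g (lemma x a) ⟩
    g (x + a + a)    ≡⟨ anti (x + a) ⟩
    - g (x + a)      ≡⟨ cong -_ (anti x) ⟩
    - - g x          ≡⟨ ℤ.neg-involutive (g x) ⟩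
    g x              ∎
    where
    open ≡-Reasoning
    lemma : ∀ x a → x + + 2 * a ≡ x + a + a
    lemma = solve-∀

  -- X + X⁻¹ + Xᶜ + X⁻ᶜ = X⁻ᶜ (1 + Xᶜ⁺¹)(1 + Xᶜ⁻¹)
  fourTerm-periodic : ∀ N .{{_ : NonZero N}} C {u} → Periodic (+ N) u →
    (∀ x → (u (x + + 1) + u (x - + 1)) + (u (x + C) + u (x - C)) ≡ + 0) →
    Periodic ((C - + 1) * (+ 2 * (C + + 1))) u
  fourTerm-periodic N C {u} per eq = Δ-periodic⇒periodic N per
    (subst (λ z → Periodic z (Δ K u)) (K≡ C) (periodic-* {g = Δ K u} (antiperiodic⇒periodic {g = Δ K u} w-anti) (C + + 1)))
    where
    open ≡-Reasoning
    K : ℤ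
    -- A common multiple of 2 (C + 1), a period of s = (1 + Xᶜ⁻¹) u, and 2 (C - 1). Since K is a
    -- period of s, 1 + Xᶜ⁻¹ annihilates `Δ K u`, which thus has period 2 (C - 1), hence K;
    -- unipotence finishes.
    K = (C - + 1) * (+ 2 * (C + + 1))
    K≡ : ∀ C → (C + + 1) * (+ 2 * (C - + 1)) ≡ (C - + 1) * (+ 2 * (C + + 1))
    K≡ = solve-∀
    s : ℤ → ℤ
    s x = u (x + (C - + 1)) + u x
    s-anti : ∀ x → s (x + (C + + 1)) ≡ - s x
    s-anti x = begin
      u (x + (C + + 1) + (C - + 1)) + u (x + (C + + 1))
        ≡⟨ cong₂ (λ a b → u a + u b) (e₁ x C) (e₂ x C) ⟩
      u (x + C + C) + u (x + C + + 1)
        ≡⟨ lemma (u (x + C + + 1)) (u (x + C - + 1)) (u (x + C + C)) (u (x + C - C)) ⟩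
      ((u (x + C + + 1) + u (x + C - + 1)) + (u (x + C + C) + u (x + C - C))) - (u (x + C - + 1) + u (x + C - C))
        ≡⟨ cong₂ _-_ (eq (x + C)) (cong₂ (λ a b → u a + u b) (e₃ x C) (e₄ x C)) ⟩
      + 0 - s x
        ≡⟨ ℤ.+-identityˡ (- s x) ⟩
      - s x ∎
      where
      lemma : ∀ a b c d → c + a ≡ ((a + b) + (c + d)) - (b + d)
      lemma = solve-∀
      e₁ : ∀ x C → x + (C + + 1) + (C - + 1) ≡ x + C + C
      e₁ = solve-∀
      e₂ : ∀ x C → x + (C + + 1) ≡ x + C + + 1
      e₂ = solve-∀
      e₃ : ∀ x C → x + C - + 1 ≡ x + (C - + 1)
      e₃ = solve-∀
      e₄ : ∀ x C → x + C - C ≡ x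
      e₄ = solve-∀
    s-periodic : Periodic K s
    s-periodic = periodic-* {g = s} (antiperiodic⇒periodic {g = s} s-anti) (C - + 1)
    w-anti : ∀ x → Δ K u (x + (C - + 1)) ≡ - Δ K u x
    w-anti x = begin
      u (x + (C - + 1) + K) - u (x + (C - + 1))
        ≡⟨ cong (λ z → u z - u (x + (C - + 1))) (+-swapʳ x (C - + 1) K) ⟩
      u (x + K + (C - + 1)) - u (x + (C - + 1))
        ≡⟨ lemma (u (x + K + (C - + 1))) (u (x + K)) (u (x + (C - + 1))) (u x) ⟩
      s (x + K) - s x - Δ K u x
        ≡⟨ cong (λ z → z - s x - Δ K u x) (s-periodic x) ⟩
      s x - s x - Δ K u x
        ≡⟨ lemma′ (s x) (Δ K u x) ⟩
      - Δ K u x ∎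
      where
      lemma : ∀ a b c d → a - c ≡ (a + b) - (c + d) - (b - d)
      lemma = solve-∀
      lemma′ : ∀ a b → a - a - b ≡ - b
      lemma′ = solve-∀

  -- The two parts determine the labelling through 6 F = 3 u + g + r, so a common period of `u` and
  -- `g` is a period of `F`.
  magic-periodic : ∀ n c m .{{_ : NonZero n}} {B F} r → n ≡ m ℕ.+ m → ¬ 3 ℕ.∣ c → Bounded B F → Periodic (+ n) F →
    (∀ x → F x + (F (x + + 1) + F (x - + 1)) + (F (x + + c) + F (x - + c)) + F (x + + m) ≡ + r) →
    ∃[ b ] ∀ q → (+ c - + 1) * (+ c + + 1) ≡ q * + 3 →
      Periodic (+ (2 ℕ.^ b) * ((+ c - + 1) * (+ 2 * (+ c + + 1)))) F
  magic-periodic n c m {B} {F} r n≡2m 3∤c FB per magic = b , λ q 3∣ x →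
    let K   = + (2 ℕ.^ b) * ((+ c - + 1) * (+ 2 * (+ c + + 1)))
        u-K = periodic-* {g = u} u-periodic (+ (2 ℕ.^ b)) x
        g-K = trans (cong (λ z → g (x + z)) (K≡ (+ (2 ℕ.^ b)) (+ c) q 3∣)) (periodic-* {g = g} g-periodic (+ 2 * q) x)
    in ℤ.*-cancelˡ-≡ (+ 6) (F (x + K)) (F x) (begin
      + 6 * F (x + K)                     ≡⟨ 6F≡ (F (x + K)) (F (x + K + + m)) (+ r) ⟩
      + 3 * u (x + K) + g (x + K) + + r   ≡⟨ cong₂ (λ y z → + 3 * y + z + + r) u-K g-K ⟩
      + 3 * u x + g x + + r               ≡⟨ 6F≡ (F x) (F (x + + m)) (+ r) ⟨
      + 6 * F x                           ∎)
    where
    open ≡-Reasoning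
    u g : ℤ → ℤ
    u x = F x - F (x + + m)
    -- Adding the relation at x and at x + m gives P (F + Xᵐ F) = 2 r. Its constant solution is r /
    -- 3, as P(1) = 6; subtracting it and scaling by 3 gives a homogeneous relation over the
    -- integers.
    g x = + 3 * (F x + F (x + + m)) - + r
    6F≡ : ∀ a b r → + 6 * a ≡ + 3 * (a - b) + (+ 3 * (a + b) - r) + r
    6F≡ = solve-∀
    K≡ : ∀ t C q → (C - + 1) * (C + + 1) ≡ q * + 3 → t * ((C - + 1) * (+ 2 * (C + + 1))) ≡ (+ 2 * q) * (t * + 3)
    K≡ t C q eq = trans (lemma₁ t C) (trans (cong (λ z → + 2 * t * z) eq) (lemma₂ t q))
      where
      lemma₁ : ∀ t C → t * ((C - + 1) * (+ 2 * (C + + 1))) ≡ + 2 * t * ((C - + 1) * (C + + 1))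
      lemma₁ = solve-∀
      lemma₂ : ∀ t q → + 2 * t * (q * + 3) ≡ (+ 2 * q) * (t * + 3)
      lemma₂ = solve-∀
    halfTurn : ∀ x → F (x + + m + + m) ≡ F x
    halfTurn x = trans (cong F (trans (ℤ.+-assoc x (+ m) (+ m)) (cong (λ z → x + + z) (sym n≡2m)))) (per x)
    shifted : ∀ x → F (x + + m) + (F (x + + 1 + + m) + F (x - + 1 + + m)) + (F (x + + c + + m) + F (x - + c + + m)) + F x ≡ + r
    shifted x = trans (cong₂ _+_ (cong₂ _+_ (cong (_+_ (F (x + + m))) (cong₂ _+_
        (cong F (+-swapʳ x (+ 1) (+ m))) (cong F (+-swapʳ x (- + 1) (+ m)))))
        (cong₂ _+_ (cong F (+-swapʳ x (+ c) (+ m))) (cong F (+-swapʳ x (- + c) (+ m))))) (sym (halfTurn x)))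
      (magic (x + + m))
    u-relation : ∀ x → (u (x + + 1) + u (x - + 1)) + (u (x + + c) + u (x - + c)) ≡ + 0
    u-relation x = begin
      (u (x + + 1) + u (x - + 1)) + (u (x + + c) + u (x - + c))
        ≡⟨ lemma (F x) (F (x + + m)) (F (x + + 1)) (F (x + + 1 + + m)) (F (x - + 1)) (F (x - + 1 + + m))
             (F (x + + c)) (F (x + + c + + m)) (F (x - + c)) (F (x - + c + + m)) ⟩
      _ ≡⟨ cong₂ _-_ (magic x) (shifted x) ⟩
      + r - + r
        ≡⟨ ℤ.+-inverseʳ (+ r) ⟩
      + 0 ∎
      where
      lemma : ∀ a a′ b b′ c c′ d d′ e e′ → ((b - b′) + (c - c′)) + ((d - d′) + (e - e′)) ≡
        (a + (b + c) + (d + e) + a′) - (a′ + (b′ + c′) + (d′ + e′) + a)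
      lemma = solve-∀
    u-periodic : Periodic ((+ c - + 1) * (+ 2 * (+ c + + 1))) u
    u-periodic = fourTerm-periodic n (+ c)
      (λ x → cong₂ _-_ (per x) (trans (cong F (+-swapʳ x (+ n) (+ m))) (per (x + + m)))) u-relation
    g-relation : ∀ x → form (+ c) (+ 1) g x ≡ + 0
    g-relation x = begin
      form (+ c) (+ 1) g x
        ≡⟨ cong (λ z → + 2 * g x + (g (x + + 1) + g (x - + 1)) + (g (x + z) + g (x - z))) (ℤ.*-identityˡ (+ c)) ⟩
      + 2 * g x + (g (x + + 1) + g (x - + 1)) + (g (x + + c) + g (x - + c))
        ≡⟨ lemma (+ r) (F x) (F (x + + m)) (F (x + + 1)) (F (x + + 1 + + m)) (F (x - + 1)) (F (x - + 1 + + m))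
             (F (x + + c)) (F (x + + c + + m)) (F (x - + c)) (F (x - + c + + m)) ⟩
      _ ≡⟨ cong₂ (λ y z → + 3 * y + + 3 * z - + 6 * + r) (magic x) (shifted x) ⟩
      + 3 * + r + + 3 * + r - + 6 * + r
        ≡⟨ lemma′ (+ r) ⟩
      + 0 ∎
      where
      lemma : ∀ r a a′ b b′ c c′ d d′ e e′ →
        + 2 * (+ 3 * (a + a′) - r) + ((+ 3 * (b + b′) - r) + (+ 3 * (c + c′) - r)) + ((+ 3 * (d + d′) - r) + (+ 3 * (e + e′) - r)) ≡
        + 3 * (a + (b + c) + (d + e) + a′) + + 3 * (a′ + (b′ + c′) + (d′ + e′) + a) - + 6 * r
      lemma = solve-∀
      lemma′ : ∀ r → + 3 * r + + 3 * r - + 6 * r ≡ + 0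
      lemma′ = solve-∀
    gB : Bounded (3 ℕ.* (B ℕ.+ B) ℕ.+ r) g
    gB x = ℕ.≤-trans (ℤ.∣i-j∣≤∣i∣+∣j∣ (+ 3 * (F x + F (x + + m))) (+ r))
      (ℕ.+-monoˡ-≤ r (ℕ.≤-trans (ℕ.≤-reflexive (ℤ.abs-* (+ 3) (F x + F (x + + m))))
        (ℕ.*-monoʳ-≤ 3 (ℕ.≤-trans (ℤ.∣i+j∣≤∣i∣+∣j∣ (F x) (F (x + + m))) (ℕ.+-mono-≤ (FB x) (FB (x + + m)))))))
    g-per : Periodic (+ n) g
    g-per x = cong₂ (λ y z → + 3 * (y + z) - + r) (per x) (trans (cong F (+-swapʳ x (+ n) (+ m))) (per (x + + m)))
    open PrimeFactorisation (factorise n)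
    stripped : ∃[ b ] Periodic (+ (2 ℕ.^ b ℕ.* 3)) g
    -- The descent starts from the period 3 n instead of n, so that the factor 3 is present even
    -- when 3 ∤ n.
    stripped = Descent.stripAll {g = g} c gB g-relation 3∤c 0 factorsPrime
      (subst (λ z → Periodic z g) (sym (trans (cong (λ z → + (3 ℕ.* z)) (sym isFactorisation)) (ℤ.pos-* 3 n)))
        (periodic-* {g = g} g-per (+ 3)))
    b : ℕ
    b = proj₁ stripped
    g-periodic : Periodic (+ (2 ℕ.^ b) * + 3) g
    g-periodic = subst (λ z → Periodic z g) (ℤ.pos-* (2 ℕ.^ b) 3) (proj₂ stripped)

  -- The labelling as a periodic function on the integers.

  module Residue (n : ℕ) .{{_ : NonZero n}} where

    ∣difference⇒≡ : ∀ {a b} → a ℕ.≤ b → b ℕ.< n → + n ℤ.∣ + b - + a → a ≡ b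
    ∣difference⇒≡ {a} {b} a≤b b<n n∣ with b ℕ.∸ a in eq
    ... | zero  = ℕ.≤-antisym a≤b (ℕ.m∸n≡0⇒m≤n eq)
    ... | suc d = contradiction (ℕ.∣⇒≤ (subst (n ℕ.∣_) ∣b-a∣≡ (ℤ.∣⇒∣ᵤ n∣)))
                    (ℕ.<⇒≱ (ℕ.≤-<-trans (subst (ℕ._≤ b) eq (ℕ.m∸n≤m b a)) b<n))
      where
      ∣b-a∣≡ : ∣ + b - + a ∣ ≡ suc d
      ∣b-a∣≡ = trans (cong ∣_∣ (trans (ℤ.m-n≡m⊖n b a) (ℤ.⊖-≥ a≤b))) eq

    ∣difference⇒≡′ : ∀ {a b} → a ℕ.< n → b ℕ.< n → + n ℤ.∣ + a - + b → a ≡ b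
    ∣difference⇒≡′ {a} {b} a<n b<n n∣ with ℕ.≤-total a b
    ... | inj₁ a≤b = ∣difference⇒≡ a≤b b<n (subst (+ n ℤ.∣_) (lemma (+ a) (+ b)) (ℤ.∣m⇒∣-m n∣))
      where
      lemma : ∀ a b → - (a - b) ≡ b - a
      lemma = solve-∀
    ... | inj₂ b≤a = sym (∣difference⇒≡ b≤a a<n n∣)

    toℕ-residue : ∀ a → toℕ (residue n a) ≡ a %ℕ n
    toℕ-residue a = Fin.toℕ-fromℕ< (n%ℕd<d a n)

    ∣-residue : ∀ a → + n ℤ.∣ + toℕ (residue n a) - a
    ∣-residue a = ℤ.divides (- (a /ℕ n)) (begin
      + toℕ (residue n a) - a                           ≡⟨ cong₂ (λ r b → + r - b) (toℕ-residue a) (a≡a%ℕn+[a/ℕn]*n a n) ⟩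
      + (a %ℕ n) - (+ (a %ℕ n) + (a /ℕ n) * + n)        ≡⟨ lemma (+ (a %ℕ n)) (a /ℕ n) (+ n) ⟩
      - (a /ℕ n) * + n                                  ∎)
      where
      open ≡-Reasoning
      lemma : ∀ r q n → r - (r + q * n) ≡ - q * n
      lemma = solve-∀

    residue-cong : ∀ a b → + n ℤ.∣ a - b → residue n a ≡ residue n b
    residue-cong a b n∣ = Fin.toℕ-injective (∣difference⇒≡′ (Fin.toℕ<n _) (Fin.toℕ<n _)
      (subst (+ n ℤ.∣_) (lemma (+ toℕ (residue n a)) (+ toℕ (residue n b)) a b)
        (ℤ.∣m∣n⇒∣m-n (ℤ.∣m∣n⇒∣m+n (∣-residue a) n∣) (∣-residue b))))
      where
      lemma : ∀ r s a b → ((r - a) + (a - b)) - (s - b) ≡ r - s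
      lemma = solve-∀

    residue-injective : ∀ a b → residue n a ≡ residue n b → + n ℤ.∣ a - b
    residue-injective a b eq = subst (+ n ℤ.∣_)
      (trans (cong (λ r → (+ toℕ (residue n b) - b) - (+ toℕ r - a)) eq) (lemma (+ toℕ (residue n b)) a b))
      (ℤ.∣m∣n⇒∣m-n (∣-residue b) (∣-residue a))
      where
      lemma : ∀ s a b → (s - b) - (s - a) ≡ a - b
      lemma = solve-∀

    residue-toℕ : ∀ u → residue n (+ toℕ u) ≡ u
    residue-toℕ u = Fin.toℕ-injective (∣difference⇒≡′ (Fin.toℕ<n _) (Fin.toℕ<n _) (∣-residue (+ toℕ u)))

  module Labelling (n c m : ℕ) .{{_ : NonZero n}} (n≡2m : n ≡ m ℕ.+ m) (1<c : 1 ℕ.< c) (c<m : c ℕ.< m)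
                   (m≡ : n ℕ./ 2 ≡ m) (f : Fin n ⤖ Fin n) (r : ℕ)
                   (magic : ∀ u → label f u ℕ.+ ListAction.sum (map (label f) (filter (adj? (Cay n (connectionSet n c)) u) (allFin n))) ≡ r)
                   where
    open Residue n

    F : ℤ → ℤ
    F x = + label f (residue n x)

    F-periodic : Periodic (+ n) F
    F-periodic x = cong (λ u → + label f u) (residue-cong (x + + n) x (ℤ.divides (+ 1) (lemma x (+ n))))
      where
      lemma : ∀ x n → x + n - x ≡ + 1 * n
      lemma = solve-∀

    F-bounded : Bounded n F
    F-bounded x = Fin.toℕ<n (Bijection.to f (residue n x))

    -- Labels are distinct, so every period of `F` is a multiple of n; this turns the period found
    -- above into a divisibility.
    F-injective : ∀ x y → F x ≡ F y → + n ℤ.∣ x - y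
    F-injective x y eq = residue-injective x y
      (Bijection.injective f (Fin.toℕ-injective (ℕ.suc-injective (ℤ.+-injective eq))))

    -- Least nonnegative representatives of S in increasing order. The bounds 1 < c < n / 2 make the
    -- chain strict, and distinctness of the five neighbours follows from it.
    steps : List ℕ
    steps = 1 ∷ c ∷ m ∷ n ℕ.∸ c ∷ n ℕ.∸ 1 ∷ []

    c<n : c ℕ.< n
    c<n = ℕ.<-≤-trans c<m (subst (m ℕ.≤_) (sym n≡2m) (ℕ.m≤m+n m m))

    m<n∸c : m ℕ.< n ℕ.∸ c
    m<n∸c = subst (λ z → m ℕ.< z ℕ.∸ c) (sym n≡2m)
      (subst (m ℕ.<_) (sym (ℕ.+-∸-assoc m (ℕ.<⇒≤ c<m))) (ℕ.m<m+n m (ℕ.m<n⇒0<n∸m c<m)))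

    steps-increasing : AllPairs (λ s t → s ℕ.< t × t ℕ.< n) steps
    steps-increasing = Linked⇒AllPairs (λ (p , _) (q , q′) → ℕ.<-trans p q , q′)
      ( (1<c , c<n)
      ∷ (c<m , ℕ.<-≤-trans m<n∸c (ℕ.m∸n≤m n c))
      ∷ (m<n∸c , ℕ.∸-monoʳ-< (ℕ.<-trans (ℕ.s≤s ℕ.z≤n) 1<c) (ℕ.<⇒≤ c<n))
      ∷ (ℕ.∸-monoʳ-< 1<c (ℕ.<⇒≤ c<n) , ℕ.∸-monoʳ-< (ℕ.s≤s ℕ.z≤n) (ℕ.<⇒≤ (ℕ.<-trans 1<c c<n)))
      ∷ [-])

    neighbour : ℤ → ℕ → Fin n
    neighbour x s = residue n (x + + s)

    neighbours-unique : ∀ x → Unique (map (neighbour x) steps)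
    neighbours-unique x = AllPairs.map⁺ (AllPairs.map distinct steps-increasing)
      where
      lemma : ∀ x s t → x + s - (x + t) ≡ s - t
      lemma = solve-∀
      distinct : ∀ {s t} → s ℕ.< t × t ℕ.< n → neighbour x s ≢ neighbour x t
      distinct {s} {t} (s<t , t<n) eq = ℕ.<⇒≢ s<t (∣difference⇒≡′ (ℕ.<-trans s<t t<n) t<n
        (subst (+ n ℤ.∣_) (lemma x (+ s) (+ t)) (residue-injective (x + + s) (x + + t) eq)))

    residue-neg : ∀ {s} → s ℕ.≤ n → residue n (- + s) ≡ residue n (+ (n ℕ.∸ s))
    residue-neg {s} s≤n = residue-cong (- + s) (+ (n ℕ.∸ s)) (ℤ.divides (- + 1) (begin
      - + s - + (n ℕ.∸ s)   ≡⟨ lemma (+ s) (+ (n ℕ.∸ s)) ⟩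
      - (+ (n ℕ.∸ s) + + s) ≡⟨ cong (λ z → - + z) (ℕ.m∸n+n≡m s≤n) ⟩
      - + n                 ≡⟨ lemma′ (+ n) ⟩
      - + 1 * + n           ∎))
      where
      open ≡-Reasoning
      lemma : ∀ a b → - a - b ≡ - (b + a)
      lemma = solve-∀
      lemma′ : ∀ a → - a ≡ - + 1 * a
      lemma′ = solve-∀

    1≤n : 1 ℕ.≤ n
    1≤n = ℕ.≤-trans (ℕ.<⇒≤ 1<c) (ℕ.<⇒≤ c<n)

    ∈connectionSet⁻ : ∀ z → z ∈ₛ connectionSet n c → ∃[ s ] s ∈ steps × z ≡ residue n (+ s)
    ∈connectionSet⁻ z z∈ with x∈p∪q⁻ ⁅ residue n (+ 1) ⁆ _ z∈
    ... | inj₁ z∈₁ = _ , here refl , x∈⁅y⁆⇒x≡y _ z∈₁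
    ... | inj₂ z∈₁ with x∈p∪q⁻ ⁅ residue n (- + 1) ⁆ _ z∈₁
    ...   | inj₁ z∈₂ = _ , there (there (there (there (here refl)))) , trans (x∈⁅y⁆⇒x≡y _ z∈₂) (residue-neg 1≤n)
    ...   | inj₂ z∈₂ with x∈p∪q⁻ ⁅ residue n (+ c) ⁆ _ z∈₂
    ...     | inj₁ z∈₃ = _ , there (here refl) , x∈⁅y⁆⇒x≡y _ z∈₃
    ...     | inj₂ z∈₃ with x∈p∪q⁻ ⁅ residue n (- + c) ⁆ _ z∈₃
    ...       | inj₁ z∈₄ = _ , there (there (there (here refl))) , trans (x∈⁅y⁆⇒x≡y _ z∈₄) (residue-neg (ℕ.<⇒≤ c<n))
    ...       | inj₂ z∈₄ = _ , there (there (here refl)) , trans (x∈⁅y⁆⇒x≡y _ z∈₄) (cong (λ z → residue n (+ z)) m≡)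

    ∈connectionSet⁺ : ∀ {s} → s ∈ steps → residue n (+ s) ∈ₛ connectionSet n c
    ∈connectionSet⁺ (here refl) = x∈p∪q⁺ (inj₁ (x∈⁅x⁆ _))
    ∈connectionSet⁺ (there (here refl)) = x∈p∪q⁺ (inj₂ (x∈p∪q⁺ (inj₂ (x∈p∪q⁺ (inj₁ (x∈⁅x⁆ _))))))
    ∈connectionSet⁺ (there (there (here refl))) = x∈p∪q⁺ (inj₂ (x∈p∪q⁺ (inj₂ (x∈p∪q⁺ (inj₂ (x∈p∪q⁺ (inj₂
      (subst (λ z → residue n (+ z) ∈ₛ ⁅ residue n (+ (n ℕ./ 2)) ⁆) m≡ (x∈⁅x⁆ _)))))))))
    ∈connectionSet⁺ (there (there (there (here refl)))) = x∈p∪q⁺ (inj₂ (x∈p∪q⁺ (inj₂ (x∈p∪q⁺ (inj₂ (x∈p∪q⁺ (inj₁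
      (subst (_∈ₛ ⁅ residue n (- + c) ⁆) (residue-neg (ℕ.<⇒≤ c<n)) (x∈⁅x⁆ _)))))))))
    ∈connectionSet⁺ (there (there (there (there (here refl))))) = x∈p∪q⁺ (inj₂ (x∈p∪q⁺ (inj₁
      (subst (_∈ₛ ⁅ residue n (- + 1) ⁆) (residue-neg 1≤n) (x∈⁅x⁆ _)))))

    Γ : Graph n
    Γ = Cay n (connectionSet n c)

    -- Duplicate-free lists with the same members are permutations of each other. Distinctness
    -- matters: coinciding steps would be counted once on the left and twice on the right.
    neighbours-↭ : ∀ x → filter (adj? Γ (residue n x)) (allFin n) ↭ map (neighbour x) steps
    neighbours-↭ x = ∼bag⇒↭ (unique∧set⇒bag (Unique.filter⁺ (adj? Γ u) (Unique.allFin⁺ n)) (neighbours-unique x)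
      (mk⇔ to from))
      where
      u : Fin n
      u = residue n x
      to : ∀ {h} → h ∈ filter (adj? Γ u) (allFin n) → h ∈ map (neighbour x) steps
      to {h} h∈ with s , s∈ , eq ← ∈connectionSet⁻ _ (proj₂ (∈-filter⁻ (adj? Γ u) {xs = allFin n} h∈)) =
        subst (_∈ map (neighbour x) steps) (trans (sym (residue-cong (+ toℕ h) (x + + s) n∣)) (residue-toℕ h))
          (∈-map⁺ (neighbour x) s∈)
        where
        lemma : ∀ h u s x → (h - u - s) + (u - x) ≡ h - (x + s)
        lemma = solve-∀
        n∣ : + n ℤ.∣ + toℕ h - (x + + s)
        n∣ = subst (+ n ℤ.∣_) (lemma (+ toℕ h) (+ toℕ u) (+ s) x)
          (ℤ.∣m∣n⇒∣m+n (residue-injective (+ toℕ h - + toℕ u) (+ s) eq) (∣-residue x))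
      from : ∀ {h} → h ∈ map (neighbour x) steps → h ∈ filter (adj? Γ u) (allFin n)
      from {h} h∈ with s , s∈ , refl ← ∈-map⁻ (neighbour x) h∈ =
        ∈-filter⁺ (adj? Γ u) (∈-allFin h) (subst (_∈ₛ connectionSet n c)
          (sym (residue-cong (+ toℕ h - + toℕ u) (+ s) n∣)) (∈connectionSet⁺ s∈))
        where
        lemma : ∀ h u s x → (h - (x + s)) - (u - x) ≡ h - u - s
        lemma = solve-∀
        n∣ : + n ℤ.∣ + toℕ h - + toℕ u - + s
        n∣ = subst (+ n ℤ.∣_) (lemma (+ toℕ h) (+ toℕ u) (+ s) x)
          (ℤ.∣m∣n⇒∣m-n (∣-residue (x + + s)) (∣-residue x))

    F-backwards : ∀ {s} → s ℕ.≤ n → ∀ x → F (x + + (n ℕ.∸ s)) ≡ F (x - + s)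
    F-backwards {s} s≤n x = trans (cong F (begin
      x + + (n ℕ.∸ s)                  ≡⟨ lemma x (+ (n ℕ.∸ s)) (+ s) ⟩
      x - + s + (+ (n ℕ.∸ s) + + s)    ≡⟨ cong (λ z → x - + s + + z) (ℕ.m∸n+n≡m s≤n) ⟩
      x - + s + + n                    ∎)) (F-periodic (x - + s))
      where
      open ≡-Reasoning
      lemma : ∀ x a s → x + a ≡ x - s + (a + s)
      lemma = solve-∀

    F-magic : ∀ x → F x + (F (x + + 1) + F (x - + 1)) + (F (x + + c) + F (x - + c)) + F (x + + m) ≡ + r
    F-magic x = begin
      F x + (F (x + + 1) + F (x - + 1)) + (F (x + + c) + F (x - + c)) + F (x + + m)
        ≡⟨ lemma (F x) (F (x + + 1)) (F (x - + 1)) (F (x + + c)) (F (x - + c)) (F (x + + m)) ⟩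
      F x + (F (x + + 1) + (F (x + + c) + (F (x + + m) + (F (x - + c) + (F (x - + 1) + + 0)))))
        ≡⟨ cong₂ (λ a b → F x + (F (x + + 1) + (F (x + + c) + (F (x + + m) + (a + (b + + 0))))))
             (F-backwards (ℕ.<⇒≤ c<n) x) (F-backwards 1≤n x) ⟨
      + (label f (residue n x) ℕ.+ ListAction.sum (map (label f) (map (neighbour x) steps)))
        ≡⟨ cong (λ z → + (label f (residue n x) ℕ.+ z)) (sum-↭ (map⁺ (label f) (neighbours-↭ x))) ⟨
      + (label f (residue n x) ℕ.+ ListAction.sum (map (label f) (filter (adj? Γ (residue n x)) (allFin n))))
        ≡⟨ cong +_ (magic (residue n x)) ⟩
      + r ∎
      where
      open ≡-Reasoning
      lemma : ∀ a b b′ c c′ m → a + (b + b′) + (c + c′) + m ≡ a + (b + (c + (m + (c′ + (b′ + + 0)))))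
      lemma = solve-∀

-- Angles of type 2 and the condition 3 ∤ c.

module _ where
  open Defs using (_≈_)

  πTerm-nonNeg : ∀ i → 0ℚ ℚ.≤ πTerm i
  πTerm-nonNeg zero    = ℚ.≤ᵇ⇒≤ _
  πTerm-nonNeg (suc i) = Convergence.*-nonneg (πTerm-nonNeg i) (Convergence./-nonneg (suc i) (3 ℕ.+ 2 ℕ.* i))

  -- The series begins with 2 and its terms are nonnegative. The index is shifted because the zeroth
  -- approximation is the empty sum.
  1≤π : ∀ k → 1ℚ ℚ.≤ seq π (suc k)
  1≤π zero    = ℚ.≤ᵇ⇒≤ _
  1≤π (suc k) = ℚ.≤-trans (1≤π k) (Convergence.≤-+nonneg (seq π (suc k)) (πTerm-nonNeg (suc k)))

  ≈-refl : ∀ x → x ≈ x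
  ≈-refl x ε 0<ε = 0 , λ k _ → subst (λ z → ℚ.∣ z ∣ ℚ.< ε) (sym (ℚ.+-inverseʳ (seq x k))) 0<ε

  -- If p and q differ, the approximations of the two multiples stay at least |p - q| apart, against
  -- closeness at ε = |p - q|. Termwise hypotheses let a sum of two multiples, as in `type2Angle`,
  -- count as one.
  π-cancel : ∀ p q {x y} → (∀ k → seq x k ≡ p ℚ.* seq π k) → (∀ k → seq y k ≡ q ℚ.* seq π k) → x ≈ y → p ≡ q
  π-cancel p q {x} {y} x≡ y≡ x≈y with p ℚ.≟ q
  ... | yes p≡q = p≡q
  ... | no  p≢q = ⊥-elim (ℚ.<-irrefl refl (ℚ.<-≤-trans (proj₂ (x≈y ε 0<ε) k (ℕ.n≤1+n N)) ε≤))
    where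
    open ℚ.≤-Reasoning
    ε : ℚ
    ε = ℚ.∣ p ℚ.- q ∣
    0<ε : 0ℚ ℚ.< ε
    0<ε with ℚ.<-cmp 0ℚ ε
    ... | tri< 0<ε _ _ = 0<ε
    ... | tri≈ _ 0≡ε _ = contradiction (p-q≡0⇒p≡q (ℚ.∣p∣≡0⇒p≡0 (p ℚ.- q) (sym 0≡ε))) p≢q
      where
      p-q≡0⇒p≡q : p ℚ.- q ≡ 0ℚ → p ≡ q
      p-q≡0⇒p≡q eq = trans (solve 2 (λ p q → p := (p :- q) :+ q) refl p q) (trans (cong (ℚ._+ q) eq) (ℚ.+-identityˡ q))
        where open +-*-Solver
    ... | tri> _ _ ε<0 = contradiction (ℚ.<-≤-trans ε<0 (ℚ.0≤∣p∣ (p ℚ.- q))) (ℚ.<-irrefl refl)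
    N k : ℕ
    N = proj₁ (x≈y ε 0<ε)
    -- Past the zeroth approximation of π, where both multiples would be 0.
    k = suc N
    ε≤ : ε ℚ.≤ ℚ.∣ seq x k ℚ.- seq y k ∣
    ε≤ = begin
      ε                                       ≡⟨ ℚ.*-identityʳ ε ⟨
      ε ℚ.* 1ℚ                                ≤⟨ ℚ.*-monoˡ-≤-nonNeg ε {{ℚ.∣-∣-nonNeg (p ℚ.- q)}} (1≤π N) ⟩
      ε ℚ.* seq π k                           ≡⟨ cong (ε ℚ.*_) (ℚ.0≤p⇒∣p∣≡p (ℚ.≤-trans (ℚ.≤ᵇ⇒≤ _) (1≤π N))) ⟨
      ε ℚ.* ℚ.∣ seq π k ∣                     ≡⟨ ℚ.∣p*q∣≡∣p∣*∣q∣ (p ℚ.- q) (seq π k) ⟨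
      ℚ.∣ (p ℚ.- q) ℚ.* seq π k ∣             ≡⟨ cong ℚ.∣_∣ (solve 3 (λ p q z → (p :- q) :* z := p :* z :- q :* z) refl p q (seq π k)) ⟩
      ℚ.∣ p ℚ.* seq π k ℚ.- q ℚ.* seq π k ∣   ≡⟨ cong₂ (λ a b → ℚ.∣ a ℚ.- b ∣) (x≡ k) (y≡ k) ⟨
      ℚ.∣ seq x k ℚ.- seq y k ∣               ∎
      where open +-*-Solver

  angle≈type2Angle : ∀ n .{{_ : NonZero n}} m s k → angle n m ≈ type2Angle s k →
                     + (2 ℕ.* m) ℤ.* + 3 ≡ ((s ◃ 2) ℤ.+ + 6 ℤ.* k) ℤ.* + n
  angle≈type2Angle n@(suc n-1) m s k eq = trans (ℚᵘ.drop-*≡* cleared) (lemma (s ◃ 2) k (+ n))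
    where
    p q r : ℚ
    p = + (2 ℕ.* m) ℚ./ n
    q = (s ◃ 2) ℚ./ 3
    r = (+ 2 ℤ.* k) ℚ./ 1
    rational : p ≡ q ℚ.+ r
    rational = π-cancel p (q ℚ.+ r) {angle n m} {type2Angle s k} (λ _ → refl)
      (λ i → sym (ℚ.*-distribʳ-+ (seq π i) q r)) eq
    cleared : mkℚᵘ (+ (2 ℕ.* m)) n-1 ℚᵘ.≃ mkℚᵘ (s ◃ 2) 2 ℚᵘ.+ mkℚᵘ (+ 2 ℤ.* k) 0
    cleared = ℚᵘ.≃-trans (ℚᵘ.≃-sym (ℚ.toℚᵘ-fromℚᵘ (mkℚᵘ (+ (2 ℕ.* m)) n-1)))
      (ℚᵘ.≃-trans (ℚ.toℚᵘ-cong rational) (ℚᵘ.≃-trans (ℚ.toℚᵘ-homo-+ q r)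
        (ℚᵘ.+-cong (ℚ.toℚᵘ-fromℚᵘ (mkℚᵘ (s ◃ 2) 2)) (ℚ.toℚᵘ-fromℚᵘ (mkℚᵘ (+ 2 ℤ.* k) 0)))))
    lemma : ∀ s k n → (s ℤ.* + 1 ℤ.+ + 2 ℤ.* k ℤ.* + 3) ℤ.* n ≡ (s ℤ.+ + 6 ℤ.* k) ℤ.* n
    lemma = solve-∀

  -- Cancelling π and clearing denominators gives 6 j = a n and 6 j c = a′ n with a and a′ of the
  -- form ± 2 + 6 k. Hence a′ = a c, and 3 ∣ c would force 3 ∣ a′.
  type2⇒3∤c : ∀ n .{{_ : NonZero n}} c j → IsType2 n c j → ¬ 3 ℕ.∣ c
  type2⇒3∤c n c j (_ , _ , s₁ , s₂ , k₁ , k₂ , angles , _) (divides q c≡3q) =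
    let s , k , eq   = integral (toℕ j) (angles {angle n (toℕ j)} (inj₁ (≈-refl (angle n (toℕ j)))))
        s′ , k′ , eq′ = integral (toℕ j ℕ.* c) (angles {angle n (toℕ j ℕ.* c)} (inj₂ (≈-refl (angle n (toℕ j ℕ.* c)))))
        open ≡-Reasoning
        multiple : (s′ ◃ 2) ℤ.+ + 6 ℤ.* k′ ≡ ((s ◃ 2) ℤ.+ + 6 ℤ.* k) ℤ.* + c
        multiple = ℤ.*-cancelʳ-≡ _ _ (+ n) (begin
          ((s′ ◃ 2) ℤ.+ + 6 ℤ.* k′) ℤ.* + n            ≡⟨ eq′ ⟨
          + (2 ℕ.* (toℕ j ℕ.* c)) ℤ.* + 3              ≡⟨ cong (λ z → + z ℤ.* + 3) (ℕ.*-assoc 2 (toℕ j) c) ⟨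
          + (2 ℕ.* toℕ j ℕ.* c) ℤ.* + 3                ≡⟨ cong (ℤ._* + 3) (ℤ.pos-* (2 ℕ.* toℕ j) c) ⟩
          + (2 ℕ.* toℕ j) ℤ.* + c ℤ.* + 3              ≡⟨ swap (+ (2 ℕ.* toℕ j)) (+ c) (+ 3) ⟩
          + (2 ℕ.* toℕ j) ℤ.* + 3 ℤ.* + c              ≡⟨ cong (ℤ._* + c) eq ⟩
          ((s ◃ 2) ℤ.+ + 6 ℤ.* k) ℤ.* + n ℤ.* + c      ≡⟨ swap ((s ◃ 2) ℤ.+ + 6 ℤ.* k) (+ n) (+ c) ⟩
          ((s ◃ 2) ℤ.+ + 6 ℤ.* k) ℤ.* + c ℤ.* + n      ∎)
        3∣c : + 3 ℤ.∣ + c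
        3∣c = ℤ.divides (+ q) (trans (cong +_ c≡3q) (ℤ.pos-* q 3))
    in 3∤±2 s′ (ℤ.∣m+n∣n⇒∣m (subst (+ 3 ℤ.∣_) (sym multiple) (ℤ.∣n⇒∣m*n ((s ◃ 2) ℤ.+ + 6 ℤ.* k) 3∣c))
         (ℤ.∣m⇒∣m*n k′ (ℤ.divides (+ 2) refl)))
    where
    instance
      +n≢0 : ℤ.NonZero (+ n)
      +n≢0 = ℤ.≢-nonZero λ eq → ℕ.≢-nonZero⁻¹ n (ℤ.+-injective eq)
    swap : ∀ a b c → a ℤ.* b ℤ.* c ≡ a ℤ.* c ℤ.* b
    swap = solve-∀
    integral : ∀ m → ｛ type2Angle s₁ k₁ , type2Angle s₂ k₂ ｝ (angle n m) →
               ∃[ s ] ∃[ k ] + (2 ℕ.* m) ℤ.* + 3 ≡ ((s ◃ 2) ℤ.+ + 6 ℤ.* k) ℤ.* + n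
    integral m (inj₁ eq) = s₁ , k₁ , angle≈type2Angle n m s₁ k₁ eq
    integral m (inj₂ eq) = s₂ , k₂ , angle≈type2Angle n m s₂ k₂ eq
    3∤2 : ¬ 3 ℕ.∣ 2
    3∤2 3∣2 = ℕ.<⇒≱ (ℕ.n<1+n 2) (ℕ.∣⇒≤ 3∣2)
    3∤±2 : ∀ s → ¬ + 3 ℤ.∣ s ◃ 2
    3∤±2 Sign.+ 3∣ = 3∤2 (ℤ.∣⇒∣ᵤ 3∣)
    3∤±2 Sign.- 3∣ = 3∤2 (ℤ.∣⇒∣ᵤ 3∣)

-- Divisibility and the factorisation of ℓ.

open import Data.Nat.Base using (_+_; _*_; _∸_; _^_; _/_; _%_; _<_; _≤_; s≤s)
open import Data.Nat.Divisibility using (_∣_)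
open import Data.Nat.GCD using (gcd)
open import Data.Nat.Properties using (*-identityˡ; *-assoc; *-comm; *-cancelˡ-≡; +-identityʳ; +-assoc; m∸n+n≡m; <⇒≤)

odd∣2^a*m⇒∣m : ∀ {l} → ¬ 2 ∣ l → ∀ a {m} → l ∣ 2 ^ a * m → l ∣ m
odd∣2^a*m⇒∣m {l} odd zero    {m} l∣ = subst (l ∣_) (*-identityˡ m) l∣
odd∣2^a*m⇒∣m {l} odd (suc a) {m} l∣ = odd∣2^a*m⇒∣m odd a
  (Coprime.coprime-divisor (prime∤⇒coprime prime[2] odd) (subst (l ∣_) (*-assoc 2 (2 ^ a) m) l∣))

-- Distribute one factor at a time: with d = gcd(l, a), d · gcd(l, b) = gcd(d l, d b) and b d =
-- gcd(b l, b a), and l divides each argument.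
∣*⇒∣gcd*gcd : ∀ {l a b} → l ∣ a * b → l ∣ gcd l a * gcd l b
∣*⇒∣gcd*gcd {l} {a} {b} l∣ab = subst (l ∣_) (sym (ℕ.c*gcd[m,n]≡gcd[cm,cn] (gcd l a) l b))
  (ℕ.gcd-greatest (ℕ.n∣m*n (gcd l a)) (subst (l ∣_) (*-comm b (gcd l a))
    (subst (l ∣_) (sym (ℕ.c*gcd[m,n]≡gcd[cm,cn] b l a)) (ℕ.gcd-greatest (ℕ.n∣m*n b) (subst (l ∣_) (*-comm a b) l∣ab)))))

coprime⇒*∣ : ∀ {a b l} → Coprime a b → a ∣ l → b ∣ l → a * b ∣ l
coprime⇒*∣ {a} {b} cop a∣l (divides q refl) = ℕ.*-monoˡ-∣ b (Coprime.coprime-divisor cop (subst (a ∣_) (*-comm q b) a∣l))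

3∤c⇒3∣c²-1 : ∀ c → ¬ 3 ∣ c → ∃[ q ] (+ c ℤ.- + 1) ℤ.* (+ c ℤ.+ + 1) ≡ q ℤ.* + 3
3∤c⇒3∣c²-1 c 3∤c = cases (c % 3) (ℕ.m≡m%n+[m/n]*n c 3) (ℕ.m%n<n c 3)
  where
  q = + (c / 3)
  cast : ∀ {r} → c ≡ r + c / 3 * 3 → + c ≡ + r ℤ.+ q ℤ.* + 3
  cast {r} eq = trans (cong +_ eq) (cong (ℤ._+_ (+ r)) (ℤ.pos-* (c / 3) 3))
  lemma₁ : ∀ q → ((+ 1 ℤ.+ q ℤ.* + 3) ℤ.- + 1) ℤ.* ((+ 1 ℤ.+ q ℤ.* + 3) ℤ.+ + 1) ≡ q ℤ.* (+ 2 ℤ.+ q ℤ.* + 3) ℤ.* + 3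
  lemma₁ = solve-∀
  lemma₂ : ∀ q → ((+ 2 ℤ.+ q ℤ.* + 3) ℤ.- + 1) ℤ.* ((+ 2 ℤ.+ q ℤ.* + 3) ℤ.+ + 1) ≡ (+ 1 ℤ.+ q ℤ.* + 3) ℤ.* (q ℤ.+ + 1) ℤ.* + 3
  lemma₂ = solve-∀
  cases : ∀ r → c ≡ r + c / 3 * 3 → r < 3 → ∃[ q ] (+ c ℤ.- + 1) ℤ.* (+ c ℤ.+ + 1) ≡ q ℤ.* + 3
  cases 0 eq _ = contradiction (divides (c / 3) eq) 3∤c
  cases 1 eq _ = q ℤ.* (+ 2 ℤ.+ q ℤ.* + 3) , trans (cong (λ z → (z ℤ.- + 1) ℤ.* (z ℤ.+ + 1)) (cast eq)) (lemma₁ q)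
  cases 2 eq _ = (+ 1 ℤ.+ q ℤ.* + 3) ℤ.* (q ℤ.+ + 1) , trans (cong (λ z → (z ℤ.- + 1) ℤ.* (z ℤ.+ + 1)) (cast eq)) (lemma₂ q)
  cases (suc (suc (suc _))) _ (s≤s (s≤s (s≤s ())))

pos-[c-1]*[c+1] : ∀ k c → 1 ≤ c →
  + k ℤ.* ((+ c ℤ.- + 1) ℤ.* (+ 2 ℤ.* (+ c ℤ.+ + 1))) ≡ + (k * ((c ∸ 1) * (2 * (c + 1))))
pos-[c-1]*[c+1] k c 1≤c = sym (begin
  + (k * ((c ∸ 1) * (2 * (c + 1))))                       ≡⟨ ℤ.pos-* k _ ⟩
  + k ℤ.* + ((c ∸ 1) * (2 * (c + 1)))                     ≡⟨ cong (+ k ℤ.*_) (ℤ.pos-* (c ∸ 1) _) ⟩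
  + k ℤ.* (+ (c ∸ 1) ℤ.* + (2 * (c + 1)))                 ≡⟨ cong₂ (λ x y → + k ℤ.* (x ℤ.* y)) (trans (sym (ℤ.⊖-≥ 1≤c)) (sym (ℤ.m-n≡m⊖n c 1))) (ℤ.pos-* 2 (c + 1)) ⟩
  + k ℤ.* ((+ c ℤ.- + 1) ℤ.* (+ 2 ℤ.* (+ c ℤ.+ + 1)))     ∎)
  where open ≡-Reasoning

magic⇒∣ : ∀ n c .{{_ : NonZero n}} → 2 ∣ n → 1 < c → c < n / 2 →
          ClosedDistanceMagic (Cay n (connectionSet n c)) → ¬ 3 ∣ c →
          ∃[ b ] n ∣ 2 ^ b * ((c ∸ 1) * (2 * (c + 1)))
magic⇒∣ n c 2∣n 1<c c<n/2 (f , r , _ , magic) 3∤c =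
  let b , period = magic-periodic n c (n / 2) r n≡2m 3∤c F-bounded F-periodic F-magic
      q , eq     = 3∤c⇒3∣c²-1 c 3∤c
  in b , period⇒∣ (2 ^ b) (period q eq)
  where
  n≡2m : n ≡ n / 2 + n / 2
  n≡2m = trans (sym (ℕ.m/n*n≡m 2∣n)) (trans (*-comm (n / 2) 2) (cong (λ z → n / 2 + z) (+-identityʳ (n / 2))))
  open Labelling n c (n / 2) n≡2m 1<c c<n/2 refl f r magic
  period⇒∣ : ∀ k → Periodic (+ k ℤ.* ((+ c ℤ.- + 1) ℤ.* (+ 2 ℤ.* (+ c ℤ.+ + 1)))) F →
             n ∣ k * ((c ∸ 1) * (2 * (c + 1)))
  period⇒∣ k per = ℤ.∣⇒∣ᵤ (subst (+ n ℤ.∣_) (trans (lemma K) (pos-[c-1]*[c+1] k c (<⇒≤ 1<c)))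
    (F-injective (+ 0 ℤ.+ K) (+ 0) (per (+ 0))))
    where
    K : ℤ
    K = + k ℤ.* ((+ c ℤ.- + 1) ℤ.* (+ 2 ℤ.* (+ c ℤ.+ + 1)))
    lemma : ∀ K → + 0 ℤ.+ K ℤ.- + 0 ≡ K
    lemma = solve-∀

odd-divisor : ∀ {l} → ¬ 2 ∣ l → ∀ a b k {x y u v} → x ≡ 2 ^ a * u → y ≡ 2 ^ b * v → l ∣ 2 ^ k * (x * (2 * y)) → l ∣ v * u
odd-divisor {l} odd a b k {x} {y} {u} {v} x≡ y≡ l∣ =
  -- The exponent `suc b` absorbs the extra factor 2 standing beside y.
  odd∣2^a*m⇒∣m odd a (odd∣2^a*m⇒∣m odd (suc b) (subst (l ∣_)
    (trans (cong₂ (λ x y → x * (2 * y)) x≡ y≡) (lemma (2 ^ a) u (2 ^ b) v))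
    (odd∣2^a*m⇒∣m odd k l∣)))
  where
  lemma : ∀ x y z w → x * y * (2 * (z * w)) ≡ 2 * z * (x * (w * y))
  lemma = ℕ-solve-∀

-- The numbers d₁ and d₂ divide c + 1 and c - 1, which differ by 2, and both are odd as divisors of
-- ℓ. So they are coprime and d₁ d₂ ∣ ℓ; the converse divisibility comes from ℓ ∣ ℓ₁ ℓ₂.
gcd-factorisation : ∀ c → 1 ≤ c → ∀ α β ℓ ℓ₁ ℓ₂ → ¬ 2 ∣ ℓ → c + 1 ≡ 2 ^ α * ℓ₁ → c ∸ 1 ≡ 2 ^ β * ℓ₂ →
  ∀ {d₁ d₂} → d₁ ≡ gcd ℓ ℓ₁ → d₂ ≡ gcd ℓ ℓ₂ → ℓ ∣ ℓ₁ * ℓ₂ → ℓ ≡ d₁ * d₂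
gcd-factorisation c 1≤c α β ℓ ℓ₁ ℓ₂ oddℓ c+1≡ c-1≡ {d₁} {d₂} d₁≡ d₂≡ ℓ∣ℓ₁ℓ₂ =
  ℕ.∣-antisym (subst₂ (λ x y → ℓ ∣ x * y) (sym d₁≡) (sym d₂≡) (∣*⇒∣gcd*gcd {ℓ} {ℓ₁} {ℓ₂} ℓ∣ℓ₁ℓ₂)) (coprime⇒*∣ coprime d₁∣ℓ d₂∣ℓ)
  where
  d₁∣ℓ : d₁ ∣ ℓ
  d₁∣ℓ = subst (_∣ ℓ) (sym d₁≡) (ℕ.gcd[m,n]∣m ℓ ℓ₁)
  d₂∣ℓ : d₂ ∣ ℓ
  d₂∣ℓ = subst (_∣ ℓ) (sym d₂≡) (ℕ.gcd[m,n]∣m ℓ ℓ₂)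
  c+1≡c-1+2 : c + 1 ≡ (c ∸ 1) + 2
  c+1≡c-1+2 = trans (cong (_+ 1) (sym (m∸n+n≡m (1≤c)))) (+-assoc (c ∸ 1) 1 1)
  coprime : Coprime d₁ d₂
  coprime {g} (g∣d₁ , g∣d₂) with prime⇒irreducible prime[2] (ℕ.∣m+n∣m⇒∣n (subst (g ∣_) c+1≡c-1+2 g∣c+1) g∣c-1)
    where
    g∣c+1 : g ∣ c + 1
    g∣c+1 = subst (g ∣_) (sym c+1≡) (ℕ.∣n⇒∣m*n (2 ^ α) (ℕ.∣-trans g∣d₁ (subst (_∣ ℓ₁) (sym d₁≡) (ℕ.gcd[m,n]∣n ℓ ℓ₁))))
    g∣c-1 : g ∣ c ∸ 1
    g∣c-1 = subst (g ∣_) (sym c-1≡) (ℕ.∣n⇒∣m*n (2 ^ β) (ℕ.∣-trans g∣d₂ (subst (_∣ ℓ₂) (sym d₂≡) (ℕ.gcd[m,n]∣n ℓ ℓ₂))))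
  ... | inj₁ g≡1  = g≡1
  ... | inj₂ refl = contradiction (ℕ.∣-trans g∣d₁ d₁∣ℓ) oddℓ

proposition4p7 : (n c : ℕ) .{{_ : NonZero n}} →
    6 ≤ n → 2 ∣ n → 1 < c → c < n / 2 →
    ClosedDistanceMagic (Cay n (connectionSet n c)) →
    (t α β ℓ ℓ₁ ℓ₂ : ℕ) →
    ¬ (2 ∣ ℓ) → ¬ (2 ∣ ℓ₁) → ¬ (2 ∣ ℓ₂) →
    n ≡ 2 ^ t * ℓ → c + 1 ≡ 2 ^ α * ℓ₁ → c ∸ 1 ≡ 2 ^ β * ℓ₂ →
    (d₁ d₂ n₁ n₂ : ℕ) →
    d₁ ≡ gcd ℓ ℓ₁ → d₂ ≡ gcd ℓ ℓ₂ →
    ℓ ≡ d₁ * n₁ → ℓ ≡ d₂ * n₂ →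
    (∃[ j ] IsType2 n c j) →
    ℓ ≡ d₁ * d₂ × n ≡ 2 ^ t * d₁ * d₂ × n₁ ≡ d₂ × n₂ ≡ d₁
proposition4p7 n c {{n≢0}} _ 2∣n 1<c c<n/2 magic t α β ℓ ℓ₁ ℓ₂ oddℓ _ _ n≡ c+1≡ c-1≡ d₁ d₂ n₁ n₂ d₁≡ d₂≡ ℓ≡d₁n₁ ℓ≡d₂n₂ (j , type2) =
  ℓ≡d₁d₂ ,
  trans n≡ (trans (cong (2 ^ t *_) ℓ≡d₁d₂) (sym (*-assoc (2 ^ t) d₁ d₂))) ,
  *-cancelˡ-≡ n₁ d₂ d₁ {{d≢0 (divides n₁ (trans ℓ≡d₁n₁ (*-comm d₁ n₁)))}} (trans (sym ℓ≡d₁n₁) ℓ≡d₁d₂) ,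
  *-cancelˡ-≡ n₂ d₁ d₂ {{d≢0 (divides n₂ (trans ℓ≡d₂n₂ (*-comm d₂ n₂)))}} (trans (sym ℓ≡d₂n₂) (trans ℓ≡d₁d₂ (*-comm d₁ d₂)))
  where
  d≢0 : ∀ {d} → d ∣ ℓ → NonZero d
  d≢0 {zero}  0∣ℓ = contradiction (subst (2 ∣_) (sym (ℕ.0∣⇒≡0 0∣ℓ)) (2 ℕ.∣0)) oddℓ
  d≢0 {suc _} _   = _
  period : ∃[ b ] n ∣ 2 ^ b * ((c ∸ 1) * (2 * (c + 1)))
  period = magic⇒∣ n c 2∣n 1<c c<n/2 magic (type2⇒3∤c n {{n≢0}} c j type2)
  ℓ∣n : ℓ ∣ n
  ℓ∣n = subst (ℓ ∣_) (sym n≡) (ℕ.n∣m*n (2 ^ t))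
  ℓ≡d₁d₂ : ℓ ≡ d₁ * d₂
  ℓ≡d₁d₂ = gcd-factorisation c (<⇒≤ 1<c) α β ℓ ℓ₁ ℓ₂ oddℓ c+1≡ c-1≡ d₁≡ d₂≡
    (odd-divisor oddℓ β α (proj₁ period) c-1≡ c+1≡ (ℕ.∣-trans ℓ∣n (proj₂ period)))
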